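{- Let $G$ be a finite abelian group with $|G| \ge 5$ and let $H = \mathcal{B}_{\pm}(G)$. The following statements are equivalent: (1) $|G|$ is even; (2) $\Delta^{\ast}(H)$ contains an even element; (3) $\Delta_1(H)$ contains an even element.
   Context: For a subset $G_0$ of an abelian group $G$, a sequence over $G_0$ is a finite unordered list $S = g_1\cdots g_\ell$ of elements of $G_0$ (repetitions allowed), forming the free commutative monoid over $G_0$ under concatenation. $S$ is a plus-minus weighted zero-sum sequence if $\sum_i \epsilon_i g_i = 0$ for some $\epsilon_i\in\{+1,-1\}$; $\mathcal{B}_{\pm}(G_0)$ is the monoid of these. For a monoid $H$ with trivial unit group: an atom is a non-identity element not a product of two non-identity elements; $\mathsf{L}_H(a)$ is the set of $k$ such that $a$ is a product of $k$ atoms; $\mathcal{L}(H)=\{\mathsf{L}_H(a)\colon a\in H\}$; for finite $L=\{a_0<\dots<a_k\}$, $\Delta(L)=\{a_i-a_{i-1}\}$; $\Delta(H)=\bigcup_a\Delta(\mathsf{L}_H(a))$; a submonoid $S$ is divisor-closed if every divisor in $H$ of an element of $S$ lies in $S$; $\Delta^{\ast}(H)=\{\min\Delta(S)\colon S \text{ divisor-closed submonoid},\ \Delta(S)\ne\emptyset\}$. $\Delta_1(H)$ is the set of all $d\in\mathbb{N}$ such that for every $k\in\mathbb{N}$ there exist $L\in\mathcal{L}(H)$ and $l\in L$ with $L\cap[l, l+kd] = \{l, l+d, \dots, l+kd\}$ (i.e. $\mathcal{L}(H)$ contains sets of lengths containing, as an interval piece, arithmetic progressions with difference $d$ of arbitrary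 length). -}

module Defs where

open import Level using (Level)
open import Data.Nat using (ℕ; zero; suc; _+_; _*_; _≤_; _<_)
open import Data.Nat.Divisibility using (_∣_)
open import Data.Fin using (Fin)
import Data.Fin as F
open import Data.Vec using (Vec; lookup; zipWith; replicate)
open import Data.List using (List; []; _∷_; length)
open import Data.List.Relation.Unary.All using (All)
open import Data.Product using (Σ; ∃; _×_; _,_)
open import Data.Sum using (_⊎_)
open import Relation.Nullary using (¬_)
open import Relation.Binary.PropositionalEquality using (_≡_)
import Relation.Binary.PropositionalEquality as P
open import Algebra.Bundles using (AbelianGroup)
open import Function.Bundles using (Bijection)

FiniteEnum : ∀ {c ℓ} → AbelianGroup c ℓ → ℕ → Set _
FiniteEnum G n = Bijection (P.setoid (Fin n)) (AbelianGroup.setoid G)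

-- Sequences over a finite set of size n (free commutative monoid):
-- a sequence is its multiplicity vector; entry i = number of occurrences
-- of the i-th element.  Concatenation = pointwise sum, identity = zeros.

Seq : ℕ → Set
Seq n = Vec ℕ n

_⊕_ : ∀ {n} → Seq n → Seq n → Seq n
_⊕_ = zipWith _+_

𝟙 : ∀ {n} → Seq n
𝟙 = replicate _ 0

sumSeq : ∀ {n} → List (Seq n) → Seq n
sumSeq []       = 𝟙
sumSeq (s ∷ ss) = s ⊕ sumSeq ss

module _ {c ℓ} (G : AbelianGroup c ℓ) where
  open AbelianGroup G

  natMul : ℕ → Carrier → Carrier
  natMul zero    g = ε
  natMul (suc k) g = g ∙ natMul k g

  gsum : ∀ {n} → (Fin n → Carrier) → Carrier
  gsum {zero}  f = ε
  gsum {suc n} f = f F.zero ∙ gsum (λ i → f (F.suc i))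

  -- S is a plus-minus weighted zero-sum sequence: the occurrences of
  -- each element are split into p_i with sign +1 and q_i with sign -1,
  -- and the signed sum vanishes.
  IsPMZeroSum : ∀ {n} → (Fin n → Carrier) → Seq n → Set ℓ
  IsPMZeroSum {n} e S =
    Σ (Seq n) λ p → Σ (Seq n) λ q →
      (p ⊕ q ≡ S) ×
      (gsum (λ i → natMul (lookup p i) (e i) ∙ (natMul (lookup q i) (e i)) ⁻¹) ≈ ε)

  Bpm : ∀ {n} → FiniteEnum G n → Seq n → Set ℓ
  Bpm e = IsPMZeroSum (Bijection.to e)

-- Arithmetic of a submonoid M of the free commutative monoid Seq n
-- (given as a predicate); its unit group is trivial.

module _ {n : ℕ} {a : Level} (M : Seq n → Set a) where

  IsAtom : Seq n → Set a
  IsAtom x = M x × ¬ (x ≡ 𝟙) ×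
    (∀ y z → M y → M z → x ≡ y ⊕ z → (y ≡ 𝟙) ⊎ (z ≡ 𝟙))

  InL : Seq n → ℕ → Set a
  InL x k = Σ (List (Seq n)) λ as →
    (length as ≡ k) × All IsAtom as × (x ≡ sumSeq as)

  InΔL : Seq n → ℕ → Set a
  InΔL x d = 0 < d × Σ ℕ λ l → InL x l × InL x (l + d) ×
    (∀ m → l < m → m < l + d → ¬ InL x m)

  InΔ : ℕ → Set a
  InΔ d = Σ (Seq n) λ x → M x × InΔL x d

  IsMinΔ : ℕ → Set a
  IsMinΔ d = InΔ d × (∀ d' → InΔ d' → d ≤ d')

  InΔ₁ : ℕ → Set a
  InΔ₁ d = 0 < d × (∀ k → Σ (Seq n) λ x → M x × Σ ℕ λ l → InL x l ×
    (∀ m → l ≤ m → m ≤ l + k * d →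
      (InL x m → Σ ℕ λ j → j ≤ k × m ≡ l + j * d) ×
      (∀ j → j ≤ k → m ≡ l + j * d → InL x m)))

record DivisorClosed {n : ℕ} {a b : Level} (H : Seq n → Set a)
                     (S : Seq n → Set b) : Set (a Level.⊔ b) where
  field
    sub      : ∀ x → S x → H x
    unit     : S 𝟙
    closed   : ∀ x y → S x → S y → S (x ⊕ y)
    divisors : ∀ x y z → S x → H y → H z → x ≡ y ⊕ z → S y

-- d ∈ Δ*(H): the divisor-closed submonoids range over predicates at
-- the same universe level as H.
InΔ* : ∀ {n a} → (Seq n → Set a) → ℕ → Set (Level.suc a)
InΔ* {n} {a} H d = Σ (Seq n → Set a) λ S → DivisorClosed H S × IsMinΔ S d

Even : ℕ → Set
Even d = 2 ∣ d

module Submission where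

-- Let g ≠ 0. The element g²ⁿ of H has length n, as a product of n atoms g², and length 2k for every
-- length k of gⁿ ∈ H. If min Δ(S) is even, it divides n − 2k for a suitable g, so n is even. If d ∈ Δ₁(H)
-- is even, take a factorization in the interior of a long progression: it contains many nonzero atoms,
-- hence g²ⁿ splits off their product for some g ≠ 0, and both factorizations of g²ⁿ lead to lengths in the
-- progression; again n is even.
--
-- If n is even, there are a few nonzero elements f i of G such that every sequence over them in H is a
-- square or the product of a square with an atom V of size 2 + d, for a fixed even d. A weight that is
-- ≡ 2 mod 2d on every atom shows that all lengths of an element are congruent mod d, while V² has lengths
-- 2 and 2 + d. The atoms V are
--   a (a+u)ʳ               for a of order 2 and u of odd order, with the least odd r = d + 1 such that r (a+u) = a,
--   k (3k)³ and k³ (3k)    for k of order 8,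
--   h (h+2g) g²            for g of order 4 and h ∉ {0, 2g} of order 2,
--   (a+b+c) a b c          for independent a, b, c of order 2.

open import Defs
open import Level using (Level)
open import Data.Nat
open import Data.Nat.Properties
open import Data.Nat.Divisibility
open import Data.Nat.Induction using (<-rec)
open import Data.Nat.Solver using (module +-*-Solver)
open import Data.Fin using (Fin; zero; suc)
open import Data.Fin.Patterns
open import Data.Fin.Permutation using (permutation)
import Data.Fin as F
import Data.Fin.Properties as Fin
open import Data.Vec using (Vec; []; _∷_; lookup; sum; tabulate)
open import Data.Vec.Properties using (zipWith-assoc; zipWith-comm; zipWith-identityˡ; zipWith-identityʳ; lookup-zipWith; lookup-replicate; lookup∘tabulate; ≡-dec)
open import Data.List as List using (List; []; _∷_; length)
import Data.List.Properties as List
open import Data.List.Relation.Unary.All as All using (All; []; _∷_)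
import Data.List.Relation.Unary.All.Properties as All
open import Data.Product using (Σ; ∃; ∃₂; _×_; _,_; proj₁; proj₂)
open import Data.Sum using (_⊎_; inj₁; inj₂)
open import Function using (_∘_; _$_; case_of_)
open import Function.Bundles using (Bijection; _⇔_; mk⇔)
open import Relation.Binary using (tri<; tri≈; tri>)
open import Relation.Nullary
open import Relation.Nullary.Decidable using (decidable-stable; _×-dec_)
open import Relation.Binary.PropositionalEquality as ≡ using (_≡_; _≢_)
open import Algebra.Bundles using (AbelianGroup; CommutativeMonoid)
import Algebra.Properties.CommutativeMonoid.Sum +-0-commutativeMonoid as ℕΣ

-- Why four families suffice, and where `|G| ≥ 5` enters: if `4g ≠ 0` for some `g`, then some
-- multiple of `g` is nonzero of odd order or has order 8. Otherwise `4G = 0`, and among the groups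
-- of even order with this property the bound excludes exactly `C₂`, `C₄` and `C₂²`. This leaves
-- room for `h` outside `{0, 2g}` in exponent 4 and for three independent elements in exponent 2.
--
-- Why squares appear: in a sequence of `H` the part with sign plus and the part with sign minus
-- have the same value, so the value of the whole lies in `2G`. Over the chosen elements this is a
-- condition on the parities of the multiplicities. The small sequences that satisfy it without
-- containing `V` are excluded by bounding one signed part by the sequence.
--
-- Two obstacles in the converse direction. The element 0 is an atom on its own, so a long
-- factorization may consist mostly of zeros; their number is the same in all factorizations, and
-- they are set apart. Factorizations exist only up to double negation; this is harmless because the
-- parity of `n` is decidable.

private variable
  n : ℕ

-- The free commutative monoid and lengths of factorizations

⊕-commutativeMonoid : ℕ → CommutativeMonoid _ _
⊕-commutativeMonoid n = record
  { Carrier = Seq n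
  ; _≈_ = _≡_
  ; _∙_ = _⊕_
  ; ε = 𝟙
  ; isCommutativeMonoid = record
    { isMonoid = record
      { isSemigroup = record
        { isMagma = record { isEquivalence = ≡.isEquivalence ; ∙-cong = ≡.cong₂ _⊕_ }
        ; assoc = zipWith-assoc +-assoc }
      ; identity = zipWith-identityˡ +-identityˡ , zipWith-identityʳ +-identityʳ }
    ; comm = zipWith-comm +-comm } }

module ⊕ {n : ℕ} where
  open CommutativeMonoid (⊕-commutativeMonoid n) public using (assoc; comm; identityˡ; identityʳ; commutativeSemigroup)
  open import Algebra.Properties.CommutativeSemigroup commutativeSemigroup public using (interchange; x∙yz≈y∙xz)

_≟ˢ_ : (x y : Seq n) → Dec (x ≡ y)
_≟ˢ_ = ≡-dec _≟_

⊕-lookup : (x y : Seq n) (i : Fin n) → lookup (x ⊕ y) i ≡ lookup x i + lookup y i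
⊕-lookup x y i = lookup-zipWith _+_ i x y

𝟙-lookup : (i : Fin n) → lookup 𝟙 i ≡ 0
𝟙-lookup i = lookup-replicate i 0

lookup-ext : {x y : Seq n} → (∀ i → lookup x i ≡ lookup y i) → x ≡ y
lookup-ext {x = []}    {[]}    _  = ≡.refl
lookup-ext {x = _ ∷ _} {_ ∷ _} eq = ≡.cong₂ _∷_ (eq zero) (lookup-ext (eq ∘ suc))

sumSeq-++ : (xs ys : List (Seq n)) → sumSeq (xs List.++ ys) ≡ sumSeq xs ⊕ sumSeq ys
sumSeq-++ []       ys = ≡.sym (⊕.identityˡ _)
sumSeq-++ (x ∷ xs) ys = ≡.trans (≡.cong (x ⊕_) (sumSeq-++ xs ys)) (≡.sym (⊕.assoc x _ _))

size-⊕ : (x y : Seq n) → sum (x ⊕ y) ≡ sum x + sum y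
size-⊕ []      []      = ≡.refl
size-⊕ (a ∷ x) (b ∷ y) = begin
  a + b + sum (x ⊕ y)       ≡⟨ ≡.cong (a + b +_) (size-⊕ x y) ⟩
  a + b + (sum x + sum y)   ≡⟨ +-assoc a b _ ⟩
  a + (b + (sum x + sum y)) ≡⟨ ≡.cong (a +_) (x∙yz≈y∙xz b (sum x) (sum y)) ⟩
  a + (sum x + (b + sum y)) ≡⟨ +-assoc a (sum x) _ ⟨
  a + sum x + (b + sum y)   ∎
  where
  open ≡.≡-Reasoning
  open import Algebra.Properties.CommutativeSemigroup +-commutativeSemigroup using (x∙yz≈y∙xz)

size-𝟙 : ∀ n → sum (𝟙 {n}) ≡ 0
size-𝟙 zero    = ≡.refl
size-𝟙 (suc n) = size-𝟙 n

size≡0⇒𝟙 : (x : Seq n) → sum x ≡ 0 → x ≡ 𝟙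
size≡0⇒𝟙 []      _  = ≡.refl
size≡0⇒𝟙 (a ∷ x) eq = ≡.cong₂ _∷_ (m+n≡0⇒m≡0 a eq) (size≡0⇒𝟙 x (m+n≡0⇒n≡0 a eq))

0<size : {x : Seq n} → x ≢ 𝟙 → 0 < sum x
0<size x≢𝟙 = n≢0⇒n>0 (x≢𝟙 ∘ size≡0⇒𝟙 _)

lookup≤size : (x : Seq n) (i : Fin n) → lookup x i ≤ sum x
lookup≤size (a ∷ x) zero    = m≤m+n a _
lookup≤size (a ∷ x) (suc i) = m≤n⇒m≤o+n a (lookup≤size x i)

size≤ : (x : Seq n) {b : ℕ} → (∀ i → lookup x i ≤ b) → sum x ≤ n * b
size≤ []      _  = z≤n
size≤ (a ∷ x) le = +-mono-≤ (le zero) (size≤ x (le ∘ suc))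

single : Fin n → ℕ → Seq n
single zero    k = k ∷ 𝟙
single (suc i) k = 0 ∷ single i k

lookup-single : (i : Fin n) (k : ℕ) → lookup (single i k) i ≡ k
lookup-single zero    k = ≡.refl
lookup-single (suc i) k = lookup-single i k

lookup-single-≢ : {i j : Fin n} (k : ℕ) → j ≢ i → lookup (single i k) j ≡ 0
lookup-single-≢ {i = zero}  {zero}  k j≢i = contradiction ≡.refl j≢i
lookup-single-≢ {i = zero}  {suc j} k j≢i = 𝟙-lookup j
lookup-single-≢ {i = suc i} {zero}  k j≢i = ≡.refl
lookup-single-≢ {i = suc i} {suc j} k j≢i = lookup-single-≢ k (j≢i ∘ ≡.cong suc)

size-single : (i : Fin n) (k : ℕ) → sum (single i k) ≡ k
size-single {suc n} zero    k = ≡.trans (≡.cong (k +_) (size-𝟙 n)) (+-identityʳ k)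
size-single         (suc i) k = size-single i k

single-+ : (i : Fin n) (k l : ℕ) → single i (k + l) ≡ single i k ⊕ single i l
single-+ zero    k l = ≡.cong (k + l ∷_) (≡.sym (⊕.identityˡ 𝟙))
single-+ (suc i) k l = ≡.cong (0 ∷_) (single-+ i k l)

single-0 : (i : Fin n) → single i 0 ≡ 𝟙
single-0 zero    = ≡.refl
single-0 (suc i) = ≡.cong (0 ∷_) (single-0 i)

single≢𝟙 : (i : Fin n) (k : ℕ) → k ≢ 0 → single i k ≢ 𝟙
single≢𝟙 i k k≢0 eq = k≢0 (≡.trans (≡.sym (lookup-single i k)) (≡.trans (≡.cong (λ x → lookup x i) eq) (𝟙-lookup i)))

split-single : (x : Seq n) (i : Fin n) {k : ℕ} → k ≤ lookup x i → ∃ λ y → x ≡ single i k ⊕ y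
split-single (a ∷ x) zero    {k} k≤a = a ∸ k ∷ x , ≡.cong₂ _∷_ (≡.sym (m+[n∸m]≡n k≤a)) (≡.sym (⊕.identityˡ x))
split-single (a ∷ x) (suc i) k≤x = let y , eq = split-single x i k≤x in a ∷ y , ≡.cong (a ∷_) eq

positive-entry : (x : Seq n) → x ≢ 𝟙 → ∃ λ i → 1 ≤ lookup x i
positive-entry []      x≢𝟙 = contradiction ≡.refl x≢𝟙
positive-entry (suc a ∷ x) x≢𝟙 = zero , s≤s z≤n
positive-entry (zero ∷ x) x≢𝟙 = let i , le = positive-entry x (x≢𝟙 ∘ ≡.cong (0 ∷_)) in suc i , le

module _ {a : Level} {M : Seq n → Set a} where

  InL-⊕ : ∀ {x y k l} → InL M x k → InL M y l → InL M (x ⊕ y) (k + l)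
  InL-⊕ (as , ≡.refl , aas , ≡.refl) (bs , ≡.refl , bbs , ≡.refl) =
    as List.++ bs , List.length-++ as , All.++⁺ aas bbs , ≡.sym (sumSeq-++ as bs)

  InL-𝟙 : InL M 𝟙 0
  InL-𝟙 = [] , ≡.refl , [] , ≡.refl

  InL-atom : ∀ {x} → IsAtom M x → InL M x 1
  InL-atom {x} at = x ∷ [] , ≡.refl , at ∷ [] , ≡.sym (⊕.identityʳ x)

  atoms-size : ∀ {as} → All (IsAtom M) as → length as ≤ sum (sumSeq as)
  atoms-size []                       = z≤n
  atoms-size {x ∷ as} (at ∷ ats) rewrite size-⊕ x (sumSeq as) =
    +-mono-≤ (0<size (proj₁ (proj₂ at))) (atoms-size ats)

  InL-size : ∀ {x k} → InL M x k → k ≤ sum x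
  InL-size (_ , ≡.refl , ats , ≡.refl) = atoms-size ats

  -- Atomicity is not decidable for an arbitrary predicate M, hence the double negation.
  factorization-exists : ∀ m x → sum x ≤ m → M x → ¬ ¬ ∃ (InL M x)
  factorization-exists zero x sz≤m Mx none = none (0 , ≡.subst (λ z → InL M z 0) (≡.sym (size≡0⇒𝟙 x (n≤0⇒n≡0 sz≤m))) InL-𝟙)
  factorization-exists (suc m) x sz≤m Mx none with x ≟ˢ 𝟙
  ... | yes ≡.refl = none (0 , InL-𝟙)
  -- Without a factorization, `x` is an atom: the factors of a proper splitting are smaller, and
  -- their factorizations would combine to one of `x`.
  ... | no x≢𝟙 = none (1 , InL-atom (Mx , x≢𝟙 , split))
    where
    smaller : ∀ y z → z ≢ 𝟙 → x ≡ y ⊕ z → sum y ≤ m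
    smaller y z z≢𝟙 ≡.refl = s≤s⁻¹ $ begin
      suc (sum y)   ≡⟨ +-comm 1 (sum y) ⟩
      sum y + 1     ≤⟨ +-monoʳ-≤ (sum y) (0<size z≢𝟙) ⟩
      sum y + sum z ≡⟨ size-⊕ y z ⟨
      sum (y ⊕ z)   ≤⟨ sz≤m ⟩
      suc m         ∎
      where open ≤-Reasoning
    split : ∀ y z → M y → M z → x ≡ y ⊕ z → (y ≡ 𝟙) ⊎ (z ≡ 𝟙)
    split y z My Mz eq with y ≟ˢ 𝟙 | z ≟ˢ 𝟙
    ... | yes y≡𝟙 | _       = inj₁ y≡𝟙
    ... | no _    | yes z≡𝟙 = inj₂ z≡𝟙
    ... | no y≢𝟙  | no z≢𝟙  = contradiction
      (λ { (k , Ly) → factorization-exists m z (smaller z y y≢𝟙 (≡.trans eq (⊕.comm y z))) Mz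
        λ { (l , Lz) → none (k + l , ≡.subst (λ w → InL M w (k + l)) (≡.sym eq) (InL-⊕ Ly Lz)) } })
      (factorization-exists m y (smaller y z z≢𝟙 eq) My)

module _ {a b : Level} {H : Seq n → Set a} {S : Seq n → Set b} (S⊆H : DivisorClosed H S) where
  open DivisorClosed S⊆H

  -- Both factors of a splitting in `H` divide `x`, so divisor-closure puts them into `S`.
  S-atom⇒H-atom : ∀ {x} → IsAtom S x → IsAtom H x
  S-atom⇒H-atom {x} (Sx , x≢𝟙 , split) = sub x Sx , x≢𝟙 , λ y z Hy Hz eq →
    split y z (divisors x y z Sx Hy Hz eq) (divisors x z y Sx Hz Hy (≡.trans eq (⊕.comm y z))) eq

  H-atom⇒S-atom : ∀ {x} → S x → IsAtom H x → IsAtom S x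
  H-atom⇒S-atom Sx (_ , x≢𝟙 , split) = Sx , x≢𝟙 , λ y z Sy Sz → split y z (sub y Sy) (sub z Sz)

  InL-S⇒H : ∀ {x k} → InL S x k → InL H x k
  InL-S⇒H (as , len , ats , eq) = as , len , All.map S-atom⇒H-atom ats , eq

  -- Each atom divides the product, the cofactor being the sum of the other atoms. Closure of `H`
  -- places this cofactor in `H`, as divisibility in `H` demands.
  InL-H⇒S : (∀ x → H x → ∀ y → H y → H (x ⊕ y)) → H 𝟙 → ∀ {x k} → S x → InL H x k → InL S x k
  InL-H⇒S H-⊕ H-𝟙 Sx (as , len , ats , ≡.refl) = as , len , go as ats Sx , ≡.refl
    where
    H-sum : ∀ {as} → All (IsAtom H) as → H (sumSeq as)
    H-sum []         = H-𝟙
    H-sum (at ∷ ats) = H-⊕ _ (proj₁ at) _ (H-sum ats)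
    go : ∀ as → All (IsAtom H) as → S (sumSeq as) → All (IsAtom S) as
    go []       []         _  = []
    go (x ∷ as) (at ∷ ats) Sx =
      H-atom⇒S-atom (divisors _ x _ Sx (proj₁ at) (H-sum ats) ≡.refl) at
      ∷ go as ats (divisors _ _ x Sx (H-sum ats) (proj₁ at) (⊕.comm x _))

-- Plus-minus weighted zero-sum sequences

module PlusMinus {c ℓ} (G : AbelianGroup c ℓ) where
  open AbelianGroup G public
  open import Algebra.Properties.Group group public using (∙-cancelʳ; ∙-cancelˡ)
  open import Algebra.Properties.CommutativeMonoid.Sum commutativeMonoid public
    renaming (sum to ∑) using (sum-cong-≋; ∑-distrib-+; sum-permute; sum-replicate; sum-replicate-zero)
  open import Algebra.Properties.CommutativeMonoid.Mult commutativeMonoid public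
    renaming (_×_ to _·_) using (×-homo-+; ×-assocˡ; ×-distrib-+; ×-congʳ; ×-homo-1)
  open import Relation.Binary.Reasoning.Setoid setoid

  natMul≡· : ∀ k g → natMul G k g ≡ k · g
  natMul≡· zero    g = ≡.refl
  natMul≡· (suc k) g = ≡.cong (g ∙_) (natMul≡· k g)

  gsum≈∑ : ∀ {n} {f h : Fin n → Carrier} → (∀ i → f i ≈ h i) → gsum G f ≈ ∑ h
  gsum≈∑ {zero}  f≈h = refl
  gsum≈∑ {suc n} f≈h = ∙-cong (f≈h zero) (gsum≈∑ (f≈h ∘ suc))

  ∑-ε : ∀ {n} {f : Fin n → Carrier} → (∀ i → f i ≈ ε) → ∑ f ≈ ε
  ∑-ε {n} f≈ε = trans (sum-cong-≋ f≈ε) (sum-replicate-zero n)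

  ·-ε : ∀ k → k · ε ≈ ε
  ·-ε zero    = refl
  ·-ε (suc k) = trans (identityˡ _) (·-ε k)

  ·-annihilated : ∀ k {g} → g ≈ ε → k · g ≈ ε
  ·-annihilated k g≈ε = trans (×-congʳ k g≈ε) (·-ε k)

  module _ {n : ℕ} (f : Fin n → Carrier) where

    value : Seq n → Carrier
    value x = ∑ λ i → lookup x i · f i

    value-⊕ : ∀ x y → value (x ⊕ y) ≈ value x ∙ value y
    value-⊕ x y = trans
      (sum-cong-≋ {n} λ i → trans (reflexive (≡.cong (_· f i) (⊕-lookup x y i))) (×-homo-+ (f i) (lookup x i) (lookup y i)))
      (∑-distrib-+ {n} _ _)

    value-𝟙 : value 𝟙 ≈ ε
    value-𝟙 = ∑-ε λ i → reflexive (≡.cong (_· f i) (𝟙-lookup i))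

  value-single : ∀ {n} (f : Fin n → Carrier) i k → value f (single i k) ≈ k · f i
  value-single f zero    k = trans (∙-congˡ (value-𝟙 (f ∘ suc))) (identityʳ _)
  value-single f (suc i) k = trans (identityˡ _) (value-single (f ∘ suc) i k)

  module _ {n : ℕ} {f : Fin n → Carrier} where

    private
      M = IsPMZeroSum G f

      -- Adding `value f q` cancels all inverses: a vanishing signed sum becomes the inverse-free
      -- equation `value f p ≈ value f q`.
      signed : ∀ p q → gsum G (λ i → natMul G (lookup p i) (f i) ∙ natMul G (lookup q i) (f i) ⁻¹) ∙ value f q ≈ value f p
      signed p q = begin
        gsum G {n} _ ∙ value f q
          ≈⟨ ∙-congʳ (gsum≈∑ λ i → ∙-cong (reflexive (natMul≡· (lookup p i) (f i))) (⁻¹-cong (reflexive (natMul≡· (lookup q i) (f i))))) ⟩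
        ∑ (λ i → a i ∙ b i ⁻¹) ∙ value f q
          ≈⟨ ∑-distrib-+ {n} _ _ ⟨
        ∑ (λ i → a i ∙ b i ⁻¹ ∙ b i)
          ≈⟨ sum-cong-≋ {n} (λ i → trans (assoc _ _ _) (trans (∙-congˡ (inverseˡ _)) (identityʳ _))) ⟩
        value f p ∎
        where
        a = λ i → lookup p i · f i
        b = λ i → lookup q i · f i

    M-elim : ∀ {x} → M x → ∃₂ λ p q → p ⊕ q ≡ x × value f p ≈ value f q
    M-elim (p , q , eq , sum≈ε) = p , q , eq , (begin
      value f p            ≈⟨ signed p q ⟨
      gsum G {n} _ ∙ value f q ≈⟨ ∙-congʳ sum≈ε ⟩
      ε ∙ value f q        ≈⟨ identityˡ _ ⟩
      value f q            ∎)

    M-intro : ∀ p q → value f p ≈ value f q → M (p ⊕ q)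
    M-intro p q eq = p , q , ≡.refl , ∙-cancelʳ (value f q) _ _ (trans (signed p q) (trans eq (sym (identityˡ _))))

    M-𝟙 : M 𝟙
    M-𝟙 = ≡.subst M (⊕.identityˡ 𝟙) (M-intro 𝟙 𝟙 refl)

    M-double : ∀ y → M (y ⊕ y)
    M-double y = M-intro y y refl

    M-⊕ : ∀ x → M x → ∀ y → M y → M (x ⊕ y)
    M-⊕ x Mx y My with M-elim Mx | M-elim My
    ... | p , q , ≡.refl , pq | p′ , q′ , ≡.refl , pq′ =
      ≡.subst M (⊕.interchange p p′ q q′) $ M-intro (p ⊕ p′) (q ⊕ q′)
        (trans (value-⊕ f p p′) (trans (∙-cong pq pq′) (sym (value-⊕ f q q′))))

    M-single : ∀ i k → k · f i ≈ ε → M (single i k)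
    M-single i k kf≈ε = ≡.subst M (⊕.identityʳ _) $
      M-intro (single i k) 𝟙 (trans (value-single f i k) (trans kf≈ε (sym (value-𝟙 f))))

    -- One of the two signs is carried by at least N of the occurrences of i, and these may be dropped.
    split-multiple : ∀ {x} i N → N · f i ≈ ε → N + N ≤ suc (lookup x i) → M x → ∃ λ y → M y × x ≡ single i N ⊕ y
    split-multiple i N Nf≈ε le Mx with M-elim Mx
    ... | p , q , ≡.refl , pq with N ≤? lookup p i | N ≤? lookup q i
    ... | yes N≤p | _ = let p′ , eq = split-single p i N≤p in
      p′ ⊕ q
      , M-intro p′ q (trans (sym (drop eq)) pq)
      , ≡.trans (≡.cong (_⊕ q) eq) (⊕.assoc _ p′ q)
      where
      drop : ∀ {p p′} → p ≡ single i N ⊕ p′ → value f p ≈ value f p′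
      drop {p′ = p′} ≡.refl = trans (value-⊕ f (single i N) p′) (trans (∙-congʳ (trans (value-single f i N) Nf≈ε)) (identityˡ _))
    ... | no _ | yes N≤q = let q′ , eq = split-single q i N≤q in
      p ⊕ q′
      , M-intro p q′ (trans pq (drop eq))
      , ≡.trans (≡.cong (p ⊕_) eq) (⊕.x∙yz≈y∙xz p _ q′)
      where
      drop : ∀ {p p′} → p ≡ single i N ⊕ p′ → value f p ≈ value f p′
      drop {p′ = p′} ≡.refl = trans (value-⊕ f (single i N) p′) (trans (∙-congʳ (trans (value-single f i N) Nf≈ε)) (identityˡ _))
    -- If neither sign is carried `N` times, there are at most `2N - 2` occurrences; hence `2N - 1`
    -- are enough, and a single one if `N = 1`.
    ... | no N≰p | no N≰q = contradiction le $ <⇒≱ $ ≤-trans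
      (≤-reflexive (≡.cong suc (≡.cong suc (⊕-lookup p q i))))
      (≤-trans (≤-reflexive (≡.cong suc (≡.sym (+-suc _ _)))) (+-mono-≤ (≰⇒> N≰p) (≰⇒> N≰q)))

    -- A single occurrence carries one sign only: one of `p`, `q` is trivial, and the other has
    -- value `f i`.
    M-element⇒ε : ∀ i → M (single i 1) → f i ≈ ε
    M-element⇒ε i Mi with M-elim Mi
    ... | p , q , eq , pq with p ≟ˢ 𝟙 | q ≟ˢ 𝟙
    ... | yes ≡.refl | _ = begin
      f i                  ≈⟨ ×-homo-1 (f i) ⟨
      1 · f i              ≈⟨ value-single f i 1 ⟨
      value f (single i 1) ≡⟨ ≡.cong (value f) (≡.trans (≡.sym eq) (⊕.identityˡ q)) ⟩
      value f q            ≈⟨ pq ⟨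
      value f 𝟙            ≈⟨ value-𝟙 f ⟩
      ε                    ∎
    ... | no _ | yes ≡.refl = begin
      f i                  ≈⟨ ×-homo-1 (f i) ⟨
      1 · f i              ≈⟨ value-single f i 1 ⟨
      value f (single i 1) ≡⟨ ≡.cong (value f) (≡.trans (≡.sym eq) (⊕.identityʳ p)) ⟩
      value f p            ≈⟨ pq ⟩
      value f 𝟙            ≈⟨ value-𝟙 f ⟩
      ε                    ∎
    ... | no p≢𝟙 | no q≢𝟙 = contradiction (+-mono-≤ (0<size p≢𝟙) (0<size q≢𝟙))
      (<⇒≱ (s≤s (≤-reflexive (≡.trans (≡.sym (size-⊕ p q)) (≡.trans (≡.cong sum eq) (size-single i 1))))))

    -- A factor in a proper splitting has size 1, hence is `f i` alone, which is in the monoid only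
    -- if it is zero.
    square-atom : ∀ i → ¬ f i ≈ ε → IsAtom M (single i 1 ⊕ single i 1)
    square-atom i fi≉ε = M-double _ , single≢𝟙 i 2 (λ ()) ∘ ≡.trans (single-+ i 1 1) , split
      where
      module _ {y z} (eq : single i 1 ⊕ single i 1 ≡ y ⊕ z) where
        square : single i 2 ≡ y ⊕ z
        square = ≡.trans (single-+ i 1 1) eq
        size-y : z ≢ 𝟙 → sum y ≤ 1
        size-y z≢𝟙 = +-cancelʳ-≤ 1 (sum y) 1 $ ≤-trans (+-monoʳ-≤ (sum y) (0<size z≢𝟙))
          (≤-reflexive (≡.trans (≡.sym (size-⊕ y z)) (≡.trans (≡.cong sum (≡.sym square)) (size-single i 2))))
        y≡single : y ≢ 𝟙 → z ≢ 𝟙 → y ≡ single i 1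
        y≡single y≢𝟙 z≢𝟙 with positive-entry y y≢𝟙
        ... | j , 1≤yj with split-single y j 1≤yj
        ... | y′ , ≡.refl with i Fin.≟ j
        ... | yes ≡.refl = ≡.trans (≡.cong (single i 1 ⊕_) (size≡0⇒𝟙 y′ (n≤0⇒n≡0 (+-cancelˡ-≤ 1 _ 0
              (≤-trans (≤-reflexive (≡.sym (≡.trans (size-⊕ (single i 1) y′) (≡.cong (_+ sum y′) (size-single i 1))))) (size-y z≢𝟙))))))
              (⊕.identityʳ _)
        ... | no i≢j = contradiction 1≤yj (<⇒≱ (s≤s (≤-reflexive (m+n≡0⇒m≡0 _
              (≡.trans (≡.sym (⊕-lookup y z j)) (≡.trans (≡.cong (λ w → lookup w j) (≡.sym square)) (lookup-single-≢ 2 (i≢j ∘ ≡.sym))))))))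
      split : ∀ y z → M y → M z → single i 1 ⊕ single i 1 ≡ y ⊕ z → (y ≡ 𝟙) ⊎ (z ≡ 𝟙)
      split y z My Mz eq with y ≟ˢ 𝟙 | z ≟ˢ 𝟙
      ... | yes y≡𝟙 | _       = inj₁ y≡𝟙
      ... | no _    | yes z≡𝟙 = inj₂ z≡𝟙
      ... | no y≢𝟙  | no z≢𝟙  = contradiction (M-element⇒ε i (≡.subst M (y≡single eq y≢𝟙 z≢𝟙) My)) fi≉ε

    double-InL : ∀ y → (∀ i → 1 ≤ lookup y i → ¬ f i ≈ ε) → InL M (y ⊕ y) (sum y)
    double-InL y = go (sum y) y ≡.refl
      where
      go : ∀ s y → s ≡ sum y → (∀ i → 1 ≤ lookup y i → ¬ f i ≈ ε) → InL M (y ⊕ y) s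
      go zero y 0≡ _ rewrite size≡0⇒𝟙 y (≡.sym 0≡) = ≡.subst (λ x → InL M x 0) (≡.sym (⊕.identityˡ 𝟙)) InL-𝟙
      go (suc s) y s≡ nonzero with positive-entry y (λ { ≡.refl → 0≢1+n (≡.trans (≡.sym (size-𝟙 n)) (≡.sym s≡)) })
      ... | i , 1≤yi with split-single y i 1≤yi
      ... | y′ , ≡.refl = ≡.subst (λ x → InL M x (suc s)) (⊕.interchange _ _ y′ y′) $
        InL-⊕ (InL-atom (square-atom i (nonzero i 1≤yi))) $
        go s y′ (suc-injective (≡.trans s≡ (≡.trans (size-⊕ (single i 1) y′) (≡.cong (_+ sum y′) (size-single i 1)))))
          λ j 1≤ → nonzero j (≤-trans 1≤ (≤-trans (m≤n+m _ _) (≤-reflexive (≡.sym (⊕-lookup (single i 1) y′ j)))))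

    -- Otherwise `gᴺ`, itself in the monoid, splits off with a nontrivial cofactor. In a finite
    -- group this bounds the size of all atoms.
    atom-multiplicity : ∀ {x} → IsAtom M x → ∀ i N → 0 < N → N · f i ≈ ε → lookup x i < N + N
    atom-multiplicity {x} (Mx , _ , split) i N 0<N Nf≈ε with N + N ≤? lookup x i
    ... | no N+N≰x = ≰⇒> N+N≰x
    ... | yes N+N≤x with split-multiple i N Nf≈ε (m≤n⇒m≤1+n N+N≤x) Mx
    ... | y , My , eq with split (single i N) y (M-single i N Nf≈ε) My eq
    ... | inj₁ eq′ = contradiction eq′ (single≢𝟙 i N (>⇒≢ 0<N))
    ... | inj₂ ≡.refl = contradiction N+N≤x $ <⇒≱ $ ≤-trans
      (s≤s (≤-reflexive (≡.trans (≡.cong (λ w → lookup w i) (≡.trans eq (⊕.identityʳ _))) (lookup-single i N))))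
      (+-monoˡ-≤ N 0<N)

-- Even distances force even order

m+m-even : ∀ m → Even (m + m)
m+m-even m = divides m (≡.trans (≡.cong (m +_) (≡.sym (+-identityʳ m))) (*-comm 2 m))

-- Subtraction gives `n - 2k = (j - j′)d`; the proof adds the equations crosswise to stay in ℕ.
progression-parity : ∀ {d l rest n k s j j′} → Even d → rest + (n + s) ≡ l + j * d → rest + (k + k + s) ≡ l + j′ * d → Even n
progression-parity {d} {l} {rest} {n} {k} {s} {j} {j′} 2∣d eq eq′ =
  ∣m+n∣m⇒∣n (≡.subst Even same (∣m∣n⇒∣m+n (∣n⇒∣m*n j 2∣d) (m+m-even k))) (∣n⇒∣m*n j′ 2∣d)
  where
  open ≡.≡-Reasoning
  open +-*-Solver
  same : j * d + (k + k) ≡ j′ * d + n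
  same = +-cancelˡ-≡ (l + (rest + s)) _ _ (begin
    l + (rest + s) + (j * d + (k + k))  ≡⟨ solve 5 (λ l r s x m → l :+ (r :+ s) :+ (x :+ m) := l :+ x :+ (r :+ (m :+ s))) ≡.refl l rest s (j * d) (k + k) ⟩
    l + j * d + (rest + (k + k + s))    ≡⟨ ≡.cong₂ _+_ (≡.sym eq) eq′ ⟩
    rest + (n + s) + (l + j′ * d)       ≡⟨ solve 5 (λ l r s x n → r :+ (n :+ s) :+ (l :+ x) := l :+ (r :+ s) :+ (x :+ n)) ≡.refl l rest s (j′ * d) n ⟩
    l + (rest + s) + (j′ * d + n)       ∎)

module MinimalDistance {a : Level} {S : Seq n → Set a} (S-⊕ : ∀ x y → S x → S y → S (x ⊕ y)) {d : ℕ} where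

  -- A difference belongs to `InΔ` only if no length lies in between. Induction on δ secures this:
  -- an intermediate length would give a smaller difference, again below `d`.
  gap-bound : (∀ d′ → InΔ S d′ → d ≤ d′) → ∀ {w a} → S w → InL S w a →
              ∀ δ → InL S w (a + δ) → 0 < δ → δ ≮ d
  gap-bound minimal {w} {a} Sw La = <-rec _ go
    where
    go : ∀ δ → (∀ {δ′} → δ′ < δ → InL S w (a + δ′) → 0 < δ′ → δ′ ≮ d) →
         InL S w (a + δ) → 0 < δ → δ ≮ d
    go δ rec Lδ 0<δ δ<d = contradiction δ<d $ ≤⇒≯ $ minimal δ (w , Sw , 0<δ , a , La , Lδ , between)
      where
      between : ∀ m → a < m → m < a + δ → ¬ InL S w m
      between m a<m m<a+δ Lm with m ∸ a | m+[n∸m]≡n (<⇒≤ a<m)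
      ... | δ′ | ≡.refl = rec δ′<δ Lm (+-cancelˡ-< a 0 δ′ (≤-trans (s≤s (≤-reflexive (+-identityʳ a))) a<m)) (<-trans δ′<δ δ<d)
        where δ′<δ = +-cancelˡ-< a δ′ δ m<a+δ

  -- Multiplying by an element with lengths l and l + d reduces the difference δ by d.
  minimal-divides : IsMinΔ S d → ∀ δ {w a} → S w → InL S w a → InL S w (a + δ) → d ∣ δ
  minimal-divides ((z , Sz , 0<d , l , Ll , Lld , _) , minimal) = <-rec _ go
    where
    go : ∀ δ → (∀ {δ′} → δ′ < δ → ∀ {w a} → S w → InL S w a → InL S w (a + δ′) → d ∣ δ′) →
         ∀ {w a} → S w → InL S w a → InL S w (a + δ) → d ∣ δ
    go zero rec Sw La Lδ = d ∣0
    go δ@(suc _) rec {w} {a} Sw La Lδ with d ≤? δ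
    ... | no d≰δ = contradiction (≰⇒> d≰δ) (gap-bound minimal Sw La δ Lδ (s≤s z≤n))
    ... | yes d≤δ = ≡.subst (d ∣_) (m+[n∸m]≡n d≤δ) $ ∣m∣n⇒∣m+n ∣-refl $
      rec (∸-monoʳ-< {δ} 0<d d≤δ) (S-⊕ z w Sz Sw) (InL-⊕ Lld La)
        (≡.subst (InL S (z ⊕ w)) lengths (InL-⊕ Ll Lδ))
      where
      open ≡.≡-Reasoning
      lengths : l + (a + δ) ≡ l + d + a + (δ ∸ d)
      lengths = begin
        l + (a + δ)               ≡⟨ ≡.cong (λ δ → l + (a + δ)) (m+[n∸m]≡n d≤δ) ⟨
        l + (a + (d + (δ ∸ d)))   ≡⟨ ≡.cong (l +_) (x∙yz≈y∙xz a d _) ⟩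
        l + (d + (a + (δ ∸ d)))   ≡⟨ +-assoc l d _ ⟨
        l + d + (a + (δ ∸ d))     ≡⟨ +-assoc (l + d) a _ ⟨
        l + d + a + (δ ∸ d)       ∎
        where open import Algebra.Properties.CommutativeSemigroup +-commutativeSemigroup using (x∙yz≈y∙xz)

  same-parity : Even d → IsMinΔ S d → ∀ {w a b} → S w → InL S w a → InL S w b → Even a → Even b
  same-parity 2∣d minimal {a = a} {b} Sw La Lb 2∣a with ≤-total a b
  ... | inj₁ a≤b with b ∸ a | m+[n∸m]≡n a≤b
  ... | δ | ≡.refl = ∣m∣n⇒∣m+n 2∣a (∣-trans 2∣d (minimal-divides minimal δ Sw La Lb))
  same-parity 2∣d minimal {a = a} {b} Sw La Lb 2∣a | inj₂ b≤a with a ∸ b | m+[n∸m]≡n b≤a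
  ... | δ | ≡.refl = ∣m+n∣m⇒∣n (≡.subst Even (+-comm b δ) 2∣a) (∣-trans 2∣d (minimal-divides minimal δ Sw Lb La))

-- Finite groups: zeros, the sequences g²ⁿ, and exchanges inside a factorization

module Finite {c ℓ} (G : AbelianGroup c ℓ) (n : ℕ) (e : FiniteEnum G n) where
  open PlusMinus G public

  el : Fin n → Carrier
  el = Bijection.to e

  el-injective : ∀ {i j} → el i ≈ el j → i ≡ j
  el-injective = Bijection.injective e

  index : Carrier → Fin n
  index g = proj₁ (Bijection.surjective e g)

  el-index : ∀ g → el (index g) ≈ g
  el-index g = proj₂ (Bijection.surjective e g) ≡.refl

  _≈?_ : ∀ g h → Dec (g ≈ h)
  g ≈? h with index g Fin.≟ index h
  ... | yes eq = yes (trans (sym (el-index g)) (trans (reflexive (≡.cong el eq)) (el-index h)))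
  ... | no neq = no λ g≈h → neq (el-injective (trans (el-index g) (trans g≈h (sym (el-index h)))))

  -- Translation by `g` permutes the group, so adding `g` to each of the `n` summands of `∑ el` does
  -- not change the sum.
  lagrange : ∀ g → n · g ≈ ε
  lagrange g = ∙-cancelʳ (∑ el) _ _ $ begin
    n · g ∙ ∑ el                     ≈⟨ ∙-congʳ (sum-replicate n) ⟨
    ∑ (λ (_ : Fin n) → g) ∙ ∑ el     ≈⟨ ∑-distrib-+ {n} _ _ ⟨
    ∑ (λ i → g ∙ el i)               ≈⟨ sum-cong-≋ {n} (λ i → el-index (g ∙ el i)) ⟨
    ∑ (λ i → el (index (g ∙ el i)))  ≈⟨ sum-permute el π ⟨
    ∑ el                             ≈⟨ identityˡ _ ⟨
    ε ∙ ∑ el                         ∎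
    where
    open import Relation.Binary.Reasoning.Setoid setoid
    translate-inverse : ∀ g h → h ∙ g ≈ ε → ∀ i → index (h ∙ el (index (g ∙ el i))) ≡ i
    translate-inverse g h hg≈ε i = el-injective $ begin
      el (index (h ∙ el (index (g ∙ el i)))) ≈⟨ el-index _ ⟩
      h ∙ el (index (g ∙ el i))              ≈⟨ ∙-congˡ (el-index _) ⟩
      h ∙ (g ∙ el i)                         ≈⟨ assoc h g _ ⟨
      h ∙ g ∙ el i                           ≈⟨ ∙-congʳ hg≈ε ⟩
      ε ∙ el i                               ≈⟨ identityˡ _ ⟩
      el i                                   ∎
    π = permutation (λ i → index (g ∙ el i)) (λ i → index (g ⁻¹ ∙ el i))
      (translate-inverse (g ⁻¹) g (inverseʳ g)) (translate-inverse g (g ⁻¹) (inverseˡ g))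

  H : Seq n → Set ℓ
  H = Bpm G e

  i₀ : Fin n
  i₀ = index ε

  el-nonzero : ∀ {i} → i ≢ i₀ → ¬ el i ≈ ε
  el-nonzero i≢i₀ eli≈ε = i≢i₀ (el-injective (trans eli≈ε (sym (el-index ε))))

  private
    0<n : 0 < n
    0<n = <-≤-trans (s≤s z≤n) (Fin.toℕ<n i₀)

  sum-zerofree : ∀ {as} → All (λ a → lookup a i₀ ≡ 0) as → lookup (sumSeq as) i₀ ≡ 0
  sum-zerofree []                  = 𝟙-lookup i₀
  sum-zerofree {a ∷ as} (eq ∷ eqs) = ≡.trans (⊕-lookup a (sumSeq as) i₀) (≡.cong₂ _+_ eq (sum-zerofree eqs))

  -- A factorization of length `k` with its atoms 0 set apart. Their number `t` is the multiplicity
  -- of 0 in `x`, hence independent of the factorization (`t-eq`).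
  record ZeroFree (x : Seq n) (k : ℕ) : Set ℓ where
    field
      atoms        : List (Seq n)
      all-atoms    : All (IsAtom H) atoms
      all-zerofree : All (λ a → lookup a i₀ ≡ 0) atoms
      t            : ℕ
      zeros        : InL H (single i₀ t) t
      sum-eq       : x ≡ single i₀ t ⊕ sumSeq atoms
      length-eq    : k ≡ t + length atoms

    t-eq : lookup x i₀ ≡ t
    t-eq = ≡.trans (≡.cong (λ x → lookup x i₀) sum-eq) $ ≡.trans (⊕-lookup (single i₀ t) _ i₀) $
      ≡.trans (≡.cong₂ _+_ (lookup-single i₀ t) (sum-zerofree all-zerofree)) (+-identityʳ t)

  -- An atom that contains 0 is 0 itself, since one zero always splits off.
  remove-zeros : ∀ {x k} → InL H x k → ZeroFree x k
  remove-zeros (as , ≡.refl , ats , ≡.refl) = go ats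
    where
    go : ∀ {as} → All (IsAtom H) as → ZeroFree (sumSeq as) (length as)
    go [] = record
      { atoms = [] ; all-atoms = [] ; all-zerofree = [] ; t = 0
      ; zeros = ≡.subst (λ x → InL H x 0) (≡.sym (single-0 i₀)) InL-𝟙
      ; sum-eq = ≡.sym (≡.trans (⊕.identityʳ _) (single-0 i₀)) ; length-eq = ≡.refl }
    go {a ∷ as} (at ∷ ats) with lookup a i₀ ≟ 0 | go ats
    ... | yes a₀≡0 | r = record
      { atoms = a ∷ r.atoms ; all-atoms = at ∷ r.all-atoms ; all-zerofree = a₀≡0 ∷ r.all-zerofree
      ; t = r.t ; zeros = r.zeros
      ; sum-eq = ≡.trans (≡.cong (a ⊕_) r.sum-eq) (⊕.x∙yz≈y∙xz a _ _)
      ; length-eq = ≡.trans (≡.cong suc r.length-eq) (≡.sym (+-suc r.t _)) }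
      where module r = ZeroFree r
    ... | no a₀≢0 | r with split-multiple i₀ 1 (trans (identityʳ _) (el-index ε)) (s≤s (n≢0⇒n>0 a₀≢0)) (proj₁ at)
    ... | y , Hy , eq with proj₂ (proj₂ at) (single i₀ 1) y (M-single i₀ 1 (trans (identityʳ _) (el-index ε))) Hy eq
    ... | inj₁ eq′ = contradiction eq′ (single≢𝟙 i₀ 1 λ ())
    ... | inj₂ ≡.refl with ≡.trans eq (⊕.identityʳ _)
    ... | ≡.refl = record
      { atoms = r.atoms ; all-atoms = r.all-atoms ; all-zerofree = r.all-zerofree ; t = suc r.t
      ; zeros = ≡.subst (λ x → InL H x (suc r.t)) (≡.sym (single-+ i₀ 1 r.t)) (InL-⊕ (InL-atom at) r.zeros)
      ; sum-eq = ≡.trans (≡.cong (single i₀ 1 ⊕_) r.sum-eq)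
          (≡.trans (≡.sym (⊕.assoc _ _ _)) (≡.cong (_⊕ _) (≡.sym (single-+ i₀ 1 r.t))))
      ; length-eq = ≡.cong suc r.length-eq }
      where module r = ZeroFree r

  -- g²ⁿ is a product of the n atoms g² as well as a square of gⁿ.
  single-n-lengths : ∀ i → ¬ el i ≈ ε →
    InL H (single i n ⊕ single i n) n × ¬ ¬ (∃ λ k → k ≤ n × InL H (single i n ⊕ single i n) (k + k))
  single-n-lengths i eli≉ε =
    ≡.subst (InL H _) (size-single i n) (double-InL (single i n) nonzero) ,
    λ none → factorization-exists n (single i n) (≤-reflexive (size-single i n)) (M-single i n (lagrange (el i)))
      λ { (k , Lk) → none (k , ≤-trans (InL-size Lk) (≤-reflexive (size-single i n)) , InL-⊕ Lk Lk) }
    where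
    nonzero : ∀ j → 1 ≤ lookup (single i n) j → ¬ el j ≈ ε
    nonzero j 1≤ with j Fin.≟ i
    ... | yes ≡.refl = eli≉ε
    ... | no j≢i = contradiction 1≤ (<⇒≱ (s≤s (≤-reflexive (lookup-single-≢ n j≢i))))

  -- If the longer factorization had only zeros as atoms, its length would be the multiplicity of 0,
  -- which every length of `x` reaches.
  nonzero-element : ∀ {x l d} → 0 < d → InL H x l → InL H x (l + d) → ∃ λ i → i ≢ i₀ × 1 ≤ lookup x i
  nonzero-element {x} {l} {d} 0<d Ll Lld with remove-zeros Ll | remove-zeros Lld
  ... | r | r′@record { atoms = [] ; t = t ; length-eq = len } =
    contradiction (m<m+n l 0<d) $ ≤⇒≯ $ begin
      l + d                ≡⟨ len ⟩
      t + 0                ≡⟨ +-identityʳ t ⟩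
      t                    ≡⟨ ZeroFree.t-eq r′ ⟨
      lookup x i₀          ≡⟨ r.t-eq ⟩
      r.t                  ≤⟨ m≤m+n r.t _ ⟩
      r.t + length r.atoms ≡⟨ r.length-eq ⟨
      l                    ∎
    where
    open ≤-Reasoning
    module r = ZeroFree r
  ... | _ | record { atoms = a ∷ as ; all-atoms = at ∷ _ ; all-zerofree = a₀≡0 ∷ _ ; t = t ; sum-eq = eq }
    with positive-entry a (proj₁ (proj₂ at))
  ... | i , 1≤ai = i , (λ { ≡.refl → contradiction 1≤ai (<⇒≱ (s≤s (≤-reflexive a₀≡0))) }) , (begin
    1                                                 ≤⟨ 1≤ai ⟩
    lookup a i                                        ≤⟨ m≤m+n _ _ ⟩
    lookup a i + lookup (sumSeq as) i                 ≡⟨ ⊕-lookup a (sumSeq as) i ⟨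
    lookup (a ⊕ sumSeq as) i                          ≤⟨ m≤n+m _ _ ⟩
    lookup (single i₀ t) i + lookup (a ⊕ sumSeq as) i ≡⟨ ⊕-lookup (single i₀ t) (a ⊕ sumSeq as) i ⟨
    lookup (single i₀ t ⊕ (a ⊕ sumSeq as)) i          ≡⟨ ≡.cong (λ x → lookup x i) eq ⟨
    lookup x i                                        ∎)
    where open ≤-Reasoning

  -- Write `x = g y`. The cofactor `y` need not be in `H`, but in `x² = g² y²` both factors are.
  double-single-∈ : ∀ {s} {S : Seq n → Set s} → DivisorClosed H S → ∀ {x i} → S x → 1 ≤ lookup x i →
                    ∀ k → S (single i k ⊕ single i k)
  double-single-∈ {S = S} S⊆H {x} {i} Sx 1≤xi = go
    where
    open DivisorClosed S⊆H
    square : S (single i 1 ⊕ single i 1)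
    square with split-single x i 1≤xi
    ... | y , ≡.refl = divisors _ _ (y ⊕ y) (closed _ _ Sx Sx) (M-double _) (M-double y) (⊕.interchange _ y _ y)
    go : ∀ k → S (single i k ⊕ single i k)
    go zero    = ≡.subst S (≡.sym (≡.trans (≡.cong₂ _⊕_ (single-0 i) (single-0 i)) (⊕.identityˡ 𝟙))) unit
    go (suc k) = ≡.subst S (≡.trans (⊕.interchange _ _ _ _) (≡.sym (≡.cong₂ _⊕_ (single-+ i 1 k) (single-+ i 1 k))))
      (closed _ _ square (go k))

  Δ*-even⇒even : ∀ {d} → Even d → InΔ* H d → Even n
  Δ*-even⇒even 2∣d (S , S⊆H , minimal@((z , Sz , 0<d , l , Ll , Lld , _) , _)) with
    nonzero-element 0<d (InL-S⇒H S⊆H Ll) (InL-S⇒H S⊆H Lld)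
  ... | i , i≢i₀ , 1≤zi with single-n-lengths i (el-nonzero i≢i₀) | double-single-∈ S⊆H Sz 1≤zi n
  -- The length `k` of `gⁿ` is known only under double negation, which decidability of `2 ∣ n`
  -- removes.
  ... | Ln , Lkk | Sg²ⁿ = decidable-stable (2 ∣? n) λ n-odd → Lkk λ { (k , _ , Lk) →
      n-odd (same-parity 2∣d minimal Sg²ⁿ (to-S Lk) (to-S Ln) (m+m-even k)) }
    where
    open MinimalDistance {S = S} (DivisorClosed.closed S⊆H)
    to-S : ∀ {k} → InL H (single i n ⊕ single i n) k → InL S (single i n ⊕ single i n) k
    to-S = InL-H⇒S S⊆H M-⊕ M-𝟙 Sg²ⁿ

  sum-atoms : ∀ {as} → All (IsAtom H) as → H (sumSeq as)
  sum-atoms []         = M-𝟙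
  sum-atoms (at ∷ ats) = M-⊕ _ (proj₁ at) _ (sum-atoms ats)

  atom-size : ∀ {x} → IsAtom H x → sum x ≤ n * (n + n)
  atom-size {x} at = size≤ x λ i → <⇒≤ (atom-multiplicity at i n 0<n (lagrange (el i)))

  sum-atoms-size : ∀ {as} → All (IsAtom H) as → sum (sumSeq as) ≤ length as * (n * (n + n))
  sum-atoms-size []                  = ≤-reflexive (size-𝟙 n)
  sum-atoms-size {a ∷ as} (at ∷ ats) = ≤-trans (≤-reflexive (size-⊕ a (sumSeq as))) (+-mono-≤ (atom-size at) (sum-atoms-size ats))

  pigeonhole : ∀ (x : Seq n) b → n * b < sum x → ∃ λ i → b < lookup x i
  pigeonhole x b lt with Fin.any? (λ i → b <? lookup x i)
  ... | yes found = found
  ... | no none   = contradiction (size≤ x λ i → ≮⇒≥ λ b<xi → none (i , b<xi)) (<⇒≱ lt)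

  -- In a factorization of `x` of length `k`, the product of `T` atoms is `g²ⁿ y` with `g ≠ 0`. Both
  -- parts may be factored anew and independently, while the `rest` other atoms stay; `size-y`
  -- limits how much the length can grow.
  record Exchangeable (x : Seq n) (k T : ℕ) : Set ℓ where
    field
      i        : Fin n
      nonzero  : i ≢ i₀
      rest     : ℕ
      rest-eq  : k ≡ rest + T
      y        : Seq n
      y∈H      : H y
      size-y   : sum y ≤ T * (n * (n + n))
      exchange : ∀ {m s} → InL H (single i n ⊕ single i n) m → InL H y s → InL H x (rest + (m + s))

  -- The product of T nonzero atoms contains some nonzero g so often that g²ⁿ splits off.
  exchangeable : ∀ {x k} (r : ZeroFree x k) T → n * (n + n + (n + n)) < T → T ≤ length (ZeroFree.atoms r) →
                 Exchangeable x k T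
  exchangeable {x} {k} r T T-large T≤length with List.take T r.atoms | List.drop T r.atoms | List.take++drop≡id T r.atoms
    | List.length-take T r.atoms | All.take⁺ T r.all-atoms | All.drop⁺ T r.all-atoms | All.take⁺ T r.all-zerofree
    where module r = ZeroFree r
  ... | bs | cs | atoms-eq | len-bs | bs-atoms | cs-atoms | bs-zerofree = record
    { i = i ; nonzero = i≢i₀ ; rest = r.t + length cs ; rest-eq = lengths ; y = y ; y∈H = proj₁ (proj₂ B-split)
    ; size-y = ≤-trans
        (≤-trans (m≤n+m (sum y) (sum (single i (n + n)))) (≤-reflexive (≡.trans (≡.sym (size-⊕ (single i (n + n)) y)) (≡.cong sum (≡.sym B-eq)))))
        (≤-trans (sum-atoms-size bs-atoms) (≤-reflexive (≡.cong (_* (n * (n + n))) length-bs)))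
    ; exchange = λ {m} {s} Lm Ls → ≡.subst (λ z → InL H z (r.t + length cs + (m + s)))
        (≡.sym (≡.trans x-eq (≡.cong (_ ⊕_) (≡.trans B-eq (≡.cong (_⊕ y) (single-+ i n n))))))
        (InL-⊕ (InL-⊕ r.zeros (cs , ≡.refl , cs-atoms , ≡.refl)) (InL-⊕ Lm Ls)) }
    where
    module r = ZeroFree r
    B = sumSeq bs
    length-bs : length bs ≡ T
    length-bs = ≡.trans len-bs (m≤n⇒m⊓n≡m T≤length)
    lengths : k ≡ r.t + length cs + T
    lengths = begin
      k                               ≡⟨ r.length-eq ⟩
      r.t + length r.atoms            ≡⟨ ≡.cong (λ as → r.t + length as) atoms-eq ⟨
      r.t + length (bs List.++ cs)    ≡⟨ ≡.cong (r.t +_) (List.length-++ bs) ⟩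
      r.t + (length bs + length cs)   ≡⟨ ≡.cong (r.t +_) (+-comm _ (length cs)) ⟩
      r.t + (length cs + length bs)   ≡⟨ +-assoc r.t _ _ ⟨
      r.t + length cs + length bs     ≡⟨ ≡.cong (r.t + length cs +_) length-bs ⟩
      r.t + length cs + T             ∎
      where open ≡.≡-Reasoning
    x-eq : x ≡ (single i₀ r.t ⊕ sumSeq cs) ⊕ B
    x-eq = begin
      x                                    ≡⟨ r.sum-eq ⟩
      single i₀ r.t ⊕ sumSeq r.atoms       ≡⟨ ≡.cong (λ as → single i₀ r.t ⊕ sumSeq as) atoms-eq ⟨
      single i₀ r.t ⊕ sumSeq (bs List.++ cs) ≡⟨ ≡.cong (single i₀ r.t ⊕_) (sumSeq-++ bs cs) ⟩
      single i₀ r.t ⊕ (B ⊕ sumSeq cs)      ≡⟨ ≡.cong (single i₀ r.t ⊕_) (⊕.comm B _) ⟩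
      single i₀ r.t ⊕ (sumSeq cs ⊕ B)      ≡⟨ ⊕.assoc _ _ B ⟨
      (single i₀ r.t ⊕ sumSeq cs) ⊕ B      ∎
      where open ≡.≡-Reasoning
    -- The product of `T` atoms has size at least `T`, which exceeds `n` times `4n`; so some element
    -- occurs more than `4n` times, and `2n` of these occurrences share a sign.
    frequent : ∃ λ i → n + n + (n + n) < lookup B i
    frequent = pigeonhole B _ (≤-trans T-large (≤-trans (≤-reflexive (≡.sym length-bs)) (atoms-size bs-atoms)))
    i = proj₁ frequent
    i≢i₀ : i ≢ i₀
    i≢i₀ i≡i₀ = n≮0 (≡.subst (n + n + (n + n) <_) (≡.trans (≡.cong (lookup B) i≡i₀) (sum-zerofree bs-zerofree)) (proj₂ frequent))
    B-split : ∃ λ y → H y × B ≡ single i (n + n) ⊕ y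
    B-split = split-multiple i (n + n) (trans (×-homo-+ (el i) n n) (trans (∙-cong (lagrange _) (lagrange _)) (identityˡ ε)))
      (m≤n⇒m≤1+n (<⇒≤ (proj₂ frequent))) (sum-atoms bs-atoms)
    y = proj₁ B-split
    B-eq = proj₂ (proj₂ B-split)

  module _ {d : ℕ} (2∣d : Even d) (0<d : 0 < d) (T E : ℕ) (T-large : n * (n + n + (n + n)) < T)
           (E-eq : E ≡ n + n + T * (n * (n + n))) where

    T≤Td : T ≤ T * d
    T≤Td = m≤m*n T d ⦃ >-nonZero 0<d ⦄

    -- The number of zeros is the same in both factorizations and at most `l`; the longer one has at
    -- least `T * d` further atoms.
    many-zerofree : ∀ {x l} → ZeroFree x l → (r : ZeroFree x (l + T * d)) → T ≤ length (ZeroFree.atoms r)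
    many-zerofree {x} {l} r r′ = ≤-trans T≤Td $ +-cancelˡ-≤ r.t (T * d) _ $ begin
      r.t + T * d               ≤⟨ +-monoˡ-≤ (T * d) (m≤m+n r.t _) ⟩
      r.t + length r.atoms + T * d ≡⟨ ≡.cong (_+ T * d) r.length-eq ⟨
      l + T * d                 ≡⟨ r′.length-eq ⟩
      r′.t + length r′.atoms    ≡⟨ ≡.cong (_+ length r′.atoms) (≡.trans (≡.sym r′.t-eq) r.t-eq) ⟩
      r.t + length r′.atoms     ∎
      where
      open ≤-Reasoning
      module r = ZeroFree r
      module r′ = ZeroFree r′

    -- The factorizations of `g²ⁿ` into `n` and into `2k` atoms are completed by the same
    -- factorization of `y`, so that only `n - 2k` remains in the comparison.
    progression-even⇒even : ∀ {x l} → InL H x l → InL H x (l + T * d) →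
      (∀ m → l ≤ m → m ≤ l + (T + E) * d → InL H x m → ∃ λ j → m ≡ l + j * d) → Even n
    progression-even⇒even {x} {l} Ll long interval
      with exchangeable (remove-zeros long) T T-large (many-zerofree (remove-zeros Ll) (remove-zeros long))
    ... | record { i = i ; nonzero = i≢i₀ ; rest = rest ; rest-eq = rest-eq ; y = y ; y∈H = Hy ; size-y = size-y ; exchange = exchange } =
      decidable-stable (2 ∣? n) λ n-odd → proj₂ g²ⁿ λ { (k , k≤n , Lk) → factorization-exists _ y ≤-refl Hy λ { (s , Ls) →
        let j  , eq  = in-progression (proj₁ g²ⁿ) (m≤m+n n n) Ls
            j′ , eq′ = in-progression Lk (+-mono-≤ k≤n k≤n) Ls
        in n-odd (progression-parity {l = l} {rest} {n} {k} {s} {j} {j′} 2∣d eq eq′) } }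
      where
      g²ⁿ = single-n-lengths i (el-nonzero i≢i₀)
      in-progression : ∀ {m s} → InL H (single i n ⊕ single i n) m → m ≤ n + n → InL H y s → ∃ λ j → rest + (m + s) ≡ l + j * d
      in-progression {m} {s} Lm m≤n+n Ls = interval (rest + (m + s)) lower upper (exchange Lm Ls)
        where
        open ≤-Reasoning
        lower : l ≤ rest + (m + s)
        lower = ≤-trans (+-cancelʳ-≤ T l rest (≤-trans (+-monoʳ-≤ l T≤Td) (≤-reflexive rest-eq))) (m≤m+n rest _)
        upper : rest + (m + s) ≤ l + (T + E) * d
        upper = begin
          rest + (m + s)          ≤⟨ +-mono-≤ (m≤m+n rest T) (+-mono-≤ m≤n+n (≤-trans (InL-size Ls) size-y)) ⟩
          rest + T + (n + n + T * (n * (n + n))) ≡⟨ ≡.cong₂ _+_ (≡.sym rest-eq) (≡.sym E-eq) ⟩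
          l + T * d + E           ≤⟨ +-monoʳ-≤ (l + T * d) (m≤m*n E d ⦃ >-nonZero 0<d ⦄) ⟩
          l + T * d + E * d       ≡⟨ +-assoc l (T * d) _ ⟩
          l + (T * d + E * d)     ≡⟨ ≡.cong (l +_) (*-distribʳ-+ d T E) ⟨
          l + (T + E) * d         ∎

    Δ₁-progression : InΔ₁ H d → Even n
    Δ₁-progression (_ , progression) with progression (T + E)
    ... | x , _ , l , Ll , interval = progression-even⇒even Ll
      (proj₂ (interval (l + T * d) (m≤m+n l _) (+-monoʳ-≤ l (*-monoˡ-≤ d (m≤m+n T E)))) T (m≤m+n T E) ≡.refl)
      λ m l≤m m≤ Lm → let j , _ , eq = proj₁ (interval m l≤m m≤) Lm in j , eq

  Δ₁-even⇒even : ∀ {d} → Even d → InΔ₁ H d → Even n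
  -- `≤-refl` selects the least admissible `T`, namely `4n² + 1`.
  Δ₁-even⇒even 2∣d Δ₁ = Δ₁-progression 2∣d (proj₁ Δ₁) _ _ ≤-refl ≡.refl Δ₁

-- Configurations and their sets of lengths

m+m≢1+n+n : ∀ m n → m + m ≢ suc (n + n)
m+m≢1+n+n m n eq = even≢odd m n $ ≡.trans (≡.cong (m +_) (+-identityʳ m)) $
  ≡.trans eq (≡.cong (λ k → suc (n + k)) (≡.sym (+-identityʳ n)))

module _ {c ℓ} (G : AbelianGroup c ℓ) where
  open PlusMinus G

  module _ {k : ℕ} (f : Fin (suc k) → Carrier) (d : ℕ) where

    -- The atoms other than the squares g². Since the entry at zero is odd, the function weight below
    -- takes on them a value ≡ 2 mod 2d, as it does on the squares.
    Special : Seq (suc k) → Set ℓ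
    Special V = IsPMZeroSum G f V × sum V ≡ 2 + d × ∃ λ m → lookup V zero ≡ suc (m + m)

    record Configuration : Set (c Level.⊔ ℓ) where
      field
        0<d      : 0 < d
        nonzero  : ∀ i → ¬ f i ≈ ε
        V₀       : Seq (suc k)
        special  : Special V₀
        classify : ∀ x → IsPMZeroSum G f x →
          (∃ λ y → x ≡ y ⊕ y) ⊎ (∃₂ λ V y → Special V × x ≡ V ⊕ (y ⊕ y))

  module ConfigurationLengths {k : ℕ} {f : Fin (suc k) → Carrier} {d : ℕ} (C : Configuration f d) where
    open Configuration C

    private
      M = IsPMZeroSum G f

    -- The size alone is 2 on squares but `2 + d` on special atoms. Adding `d` times an entry that
    -- is odd on special atoms corrects the latter modulo `2d` and changes a square by 0 or `2d`.
    weight : Seq (suc k) → ℕ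
    weight x = sum x + d * lookup x zero

    weight-⊕ : ∀ x y → weight (x ⊕ y) ≡ weight x + weight y
    weight-⊕ x y = ≡.trans (≡.cong₂ (λ s h → s + d * h) (size-⊕ x y) (⊕-lookup x y zero))
      (solve 5 (λ s t d h k → s :+ t :+ d :* (h :+ k) := s :+ d :* h :+ (t :+ d :* k)) ≡.refl (sum x) (sum y) d _ _)
      where open +-*-Solver

    special≢𝟙 : ∀ {V} → Special f d V → V ≢ 𝟙
    special≢𝟙 (_ , size , _) ≡.refl = 0≢1+n (≡.trans (≡.sym (size-𝟙 (suc k))) size)

    -- By `classify`, an atom is one square `g²` or one special `V`, since any further square would
    -- split off.
    atom-weight : ∀ {U} → IsAtom M U → ∃ λ e → weight U ≡ 2 + (d + d) * e
    atom-weight {U} (MU , U≢𝟙 , split) with classify U MU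
    ... | inj₁ (y , ≡.refl) with positive-entry y (λ { ≡.refl → U≢𝟙 (⊕.identityˡ 𝟙) })
    ... | i , 1≤yi with split-single y i 1≤yi
    ... | y′ , ≡.refl with split (single i 1 ⊕ single i 1) (y′ ⊕ y′) (M-double {f = f} _) (M-double {f = f} y′) (⊕.interchange _ y′ _ y′)
    ... | inj₁ eq = contradiction eq (proj₁ (proj₂ (square-atom {f = f} i (nonzero i))))
    ... | inj₂ eq = lookup (single i 1) zero , (begin
      weight ((single i 1 ⊕ y′) ⊕ (single i 1 ⊕ y′)) ≡⟨ ≡.cong weight (⊕.interchange (single i 1) y′ (single i 1) y′) ⟩
      weight ((single i 1 ⊕ single i 1) ⊕ (y′ ⊕ y′)) ≡⟨ ≡.cong (λ z → weight ((single i 1 ⊕ single i 1) ⊕ z)) eq ⟩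
      weight ((single i 1 ⊕ single i 1) ⊕ 𝟙) ≡⟨ ≡.cong weight (⊕.identityʳ (single i 1 ⊕ single i 1)) ⟩
      weight (single i 1 ⊕ single i 1)       ≡⟨ weight-⊕ (single i 1) (single i 1) ⟩
      weight (single i 1) + weight (single i 1) ≡⟨ ≡.cong (λ s → s + d * h + (s + d * h)) (size-single i 1) ⟩
      1 + d * h + (1 + d * h)                ≡⟨ solve 2 (λ d h → con 1 :+ d :* h :+ (con 1 :+ d :* h) := con 2 :+ (d :+ d) :* h) ≡.refl d h ⟩
      2 + (d + d) * h                        ∎)
      where
      h = lookup (single i 1) zero
      open ≡.≡-Reasoning
      open +-*-Solver
    atom-weight {U} (MU , U≢𝟙 , split) | inj₂ (V , y , SV , eq) with split V (y ⊕ y) (proj₁ SV) (M-double {f = f} y) eq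
    ... | inj₁ V≡𝟙 = contradiction V≡𝟙 (special≢𝟙 SV)
    ... | inj₂ yy≡𝟙 with ≡.trans eq (≡.trans (≡.cong (V ⊕_) yy≡𝟙) (⊕.identityʳ V)) | SV
    ... | ≡.refl | _ , size , m , head = suc m , (begin
      sum U + d * lookup U zero   ≡⟨ ≡.cong₂ (λ s h → s + d * h) size head ⟩
      2 + d + d * suc (m + m)     ≡⟨ solve 2 (λ d m → con 2 :+ d :+ d :* (con 1 :+ (m :+ m)) := con 2 :+ (d :+ d) :* (con 1 :+ m)) ≡.refl d m ⟩
      2 + (d + d) * suc m         ∎)
      where
      open ≡.≡-Reasoning
      open +-*-Solver

    length-weight : ∀ {x l} → InL M x l → ∃ λ e → weight x ≡ l + l + (d + d) * e
    length-weight (as , ≡.refl , ats , ≡.refl) = go ats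
      where
      go : ∀ {as} → All (IsAtom M) as → ∃ λ e → weight (sumSeq as) ≡ length as + length as + (d + d) * e
      go [] = 0 , ≡.trans (≡.cong₂ (λ s h → s + d * h) (size-𝟙 (suc k)) (𝟙-lookup {suc k} zero)) (≡.trans (*-zeroʳ d) (≡.sym (*-zeroʳ (d + d))))
      go {a ∷ as} (at ∷ ats) with atom-weight at | go ats
      ... | e , eq | e′ , eq′ = e + e′ , ≡.trans (weight-⊕ a (sumSeq as)) (≡.trans (≡.cong₂ _+_ eq eq′)
        (solve 4 (λ d e e′ l → con 2 :+ (d :+ d) :* e :+ (l :+ l :+ (d :+ d) :* e′) := (con 1 :+ l) :+ (con 1 :+ l) :+ (d :+ d) :* (e :+ e′)) ≡.refl d e e′ (length as)))
        where open +-*-Solver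

    -- The weight of `x` does not depend on the factorization, so twice its lengths agree modulo
    -- `2d`.
    d∣differences : ∀ {x l δ} → InL M x l → InL M x (l + δ) → d ∣ δ
    d∣differences {x} {l} {δ} Ll Lδ with length-weight Ll | length-weight Lδ
    ... | e , eq | e′ , eq′ = ∣m+n∣m⇒∣n (≡.subst (d ∣_) (≡.sym same) (m∣m*n e)) (m∣m*n e′)
      where
      open ≡.≡-Reasoning
      open +-*-Solver
      same : d * e′ + δ ≡ d * e
      same = *-cancelˡ-≡ _ _ 2 $ +-cancelˡ-≡ (l + l) _ _ (begin
        l + l + 2 * (d * e′ + δ)           ≡⟨ solve 4 (λ d e l δ → l :+ l :+ con 2 :* (d :* e :+ δ) := l :+ δ :+ (l :+ δ) :+ (d :+ d) :* e) ≡.refl d e′ l δ ⟩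
        l + δ + (l + δ) + (d + d) * e′     ≡⟨ eq′ ⟨
        weight x                           ≡⟨ eq ⟩
        l + l + (d + d) * e                ≡⟨ solve 3 (λ d e l → l :+ l :+ (d :+ d) :* e := l :+ l :+ con 2 :* (d :* e)) ≡.refl d e l ⟩
        l + l + 2 * (d * e)                ∎)

    -- Two squares cannot multiply to `V`, whose entry at zero is odd. So one factor contains a
    -- special sequence, which has the size of `V` already.
    special-atom : ∀ {V} → Special f d V → IsAtom M V
    special-atom {V} SV@(MV , size , m , head) = MV , special≢𝟙 SV , split
      where
      cofactor : ∀ {V′ y z} → Special f d V′ → V ≡ (V′ ⊕ y) ⊕ z → z ≡ 𝟙
      cofactor {V′} {y} {z} (_ , size′ , _) eq = size≡0⇒𝟙 z $ m+n≡0⇒n≡0 (sum y) $ +-cancelˡ-≡ (sum V) _ 0 $ begin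
        sum V + (sum y + sum z)  ≡⟨ ≡.cong (_+ (sum y + sum z)) (≡.trans size (≡.sym size′)) ⟩
        sum V′ + (sum y + sum z) ≡⟨ +-assoc (sum V′) _ _ ⟨
        sum V′ + sum y + sum z   ≡⟨ ≡.cong (_+ sum z) (size-⊕ V′ y) ⟨
        sum (V′ ⊕ y) + sum z     ≡⟨ size-⊕ (V′ ⊕ y) z ⟨
        sum ((V′ ⊕ y) ⊕ z)       ≡⟨ ≡.cong sum eq ⟨
        sum V                    ≡⟨ +-identityʳ _ ⟨
        sum V + 0                ∎
        where open ≡.≡-Reasoning
      split : ∀ y z → M y → M z → V ≡ y ⊕ z → (y ≡ 𝟙) ⊎ (z ≡ 𝟙)
      split y z My Mz eq with classify y My | classify z Mz
      ... | inj₂ (V′ , y′ , SV′ , ≡.refl) | _ = inj₂ (cofactor SV′ eq)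
      ... | inj₁ _ | inj₂ (V′ , z′ , SV′ , ≡.refl) = inj₁ (cofactor SV′ (≡.trans eq (⊕.comm y z)))
      ... | inj₁ (y′ , ≡.refl) | inj₁ (z′ , ≡.refl) = contradiction
        (≡.trans (solve 2 (λ a b → a :+ b :+ (a :+ b) := a :+ a :+ (b :+ b)) ≡.refl h′ h″) (≡.trans double-head head))
        (m+m≢1+n+n (h′ + h″) m)
        where
        open +-*-Solver
        h′ = lookup y′ zero
        h″ = lookup z′ zero
        double-head : h′ + h′ + (h″ + h″) ≡ lookup V zero
        double-head = ≡.trans (≡.cong₂ _+_ (≡.sym (⊕-lookup y′ y′ zero)) (≡.sym (⊕-lookup z′ z′ zero)))
          (≡.trans (≡.sym (⊕-lookup (y′ ⊕ y′) (z′ ⊕ z′) zero)) (≡.cong (λ w → lookup w zero) (≡.sym eq)))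

    special-square-2 : InL M (V₀ ⊕ V₀) 2
    special-square-2 = InL-⊕ (InL-atom (special-atom special)) (InL-atom (special-atom special))

    special-square-2+d : InL M (V₀ ⊕ V₀) (2 + d)
    special-square-2+d = ≡.subst (InL M (V₀ ⊕ V₀)) (proj₁ (proj₂ special)) (double-InL V₀ λ i _ → nonzero i)

    -- Equal values at i ≢ j would put the sequence of size 2 with entries i and j into M.
    configuration-injective : ∀ {i j} → f i ≈ f j → i ≡ j
    configuration-injective {i} {j} fi≈fj with i Fin.≟ j
    ... | yes i≡j = i≡j
    ... | no i≢j with classify (single i 1 ⊕ single j 1) (M-intro {f = f} (single i 1) (single j 1)
      (trans (value-single f i 1) (trans (×-congʳ 1 fi≈fj) (sym (value-single f j 1)))))
    ... | inj₁ (y , eq) = contradiction (≡.trans (≡.sym (⊕-lookup y y i)) (≡.trans (≡.cong (λ w → lookup w i) (≡.sym eq))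
        (≡.trans (⊕-lookup (single i 1) (single j 1) i) (≡.cong₂ _+_ (lookup-single i 1) (lookup-single-≢ 1 i≢j)))))
      (m+m≢1+n+n (lookup y i) 0)
    ... | inj₂ (V , y , (_ , size , _) , eq) = contradiction (begin
        3 + 0                            ≤⟨ +-monoˡ-≤ 0 (+-monoʳ-≤ 2 0<d) ⟩
        2 + d + 0                        ≡⟨ ≡.cong (_+ 0) size ⟨
        sum V + 0                        ≤⟨ +-monoʳ-≤ (sum V) z≤n ⟩
        sum V + sum (y ⊕ y)              ≡⟨ size-⊕ V (y ⊕ y) ⟨
        sum (V ⊕ (y ⊕ y))                ≡⟨ ≡.cong sum eq ⟨
        sum (single i 1 ⊕ single j 1)    ≡⟨ size-⊕ (single i 1) (single j 1) ⟩
        sum (single i 1) + sum (single j 1) ≡⟨ ≡.cong₂ _+_ (size-single i 1) (size-single j 1) ⟩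
        2                                ∎) λ { (s≤s (s≤s ())) }
      where open ≤-Reasoning

    power : ℕ → Seq (suc k)
    power zero    = 𝟙
    power (suc r) = (V₀ ⊕ V₀) ⊕ power r

    -- Of the `r` copies of `V₀²`, factor `j` into squares of elements and the others as `V₀ · V₀`.
    power-lengths : ∀ r j → j ≤ r → InL M (power r) (r * 2 + j * d)
    power-lengths zero    zero    _ = InL-𝟙
    power-lengths (suc r) zero    _ = InL-⊕ special-square-2 (power-lengths r zero z≤n)
    power-lengths (suc r) (suc j) (s≤s j≤r) = ≡.subst (InL M (power (suc r)))
      (solve 3 (λ d r x → con 2 :+ d :+ (r :+ x) := con 2 :+ r :+ (d :+ x)) ≡.refl d (r * 2) (j * d))
      (InL-⊕ special-square-2+d (power-lengths r j j≤r))
      where open +-*-Solver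

-- Sequences over a few elements inside the sequences over the whole group

module _ {n : ℕ} where

  embed : ∀ {k} → (Fin k → Fin n) → Seq k → Seq n
  embed {zero}  g []      = 𝟙
  embed {suc k} g (a ∷ x) = single (g zero) a ⊕ embed (g ∘ suc) x

  embed-⊕ : ∀ {k} (g : Fin k → Fin n) x y → embed g (x ⊕ y) ≡ embed g x ⊕ embed g y
  embed-⊕ g []      []      = ≡.sym (⊕.identityˡ 𝟙)
  embed-⊕ g (a ∷ x) (b ∷ y) = ≡.trans (≡.cong₂ _⊕_ (single-+ (g zero) a b) (embed-⊕ (g ∘ suc) x y)) (⊕.interchange _ _ _ _)

  embed-𝟙 : ∀ {k} (g : Fin k → Fin n) → embed g 𝟙 ≡ 𝟙
  embed-𝟙 {zero}  g = ≡.refl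
  embed-𝟙 {suc k} g = ≡.trans (≡.cong₂ _⊕_ (single-0 (g zero)) (embed-𝟙 (g ∘ suc))) (⊕.identityˡ 𝟙)

  lookup-embed-∉ : ∀ {k} (g : Fin k → Fin n) x {i} → (∀ j → i ≢ g j) → lookup (embed g x) i ≡ 0
  lookup-embed-∉ g []      {i} _   = 𝟙-lookup i
  lookup-embed-∉ g (a ∷ x) {i} i∉g = ≡.trans (⊕-lookup (single (g zero) a) _ i)
    (≡.cong₂ _+_ (lookup-single-≢ a (i∉g zero)) (lookup-embed-∉ (g ∘ suc) x (i∉g ∘ suc)))

  lookup-embed : ∀ {k} (g : Fin k → Fin n) → (∀ {i j} → g i ≡ g j → i ≡ j) → ∀ x j → lookup (embed g x) (g j) ≡ lookup x j
  lookup-embed g inj (a ∷ x) zero = ≡.trans (⊕-lookup (single (g zero) a) _ _) $ ≡.trans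
    (≡.cong₂ _+_ (lookup-single (g zero) a) (lookup-embed-∉ (g ∘ suc) x λ j eq → case inj eq of λ ())) (+-identityʳ a)
    where open import Function using (case_of_)
  lookup-embed g inj (a ∷ x) (suc j) = ≡.trans (⊕-lookup (single (g zero) a) _ _) $
    ≡.cong₂ _+_ (lookup-single-≢ a λ eq → case inj eq of λ ()) (lookup-embed (g ∘ suc) (Fin.suc-injective ∘ inj) x j)
    where open import Function using (case_of_)

  module _ {k} (g : Fin k → Fin n) (inj : ∀ {i j} → g i ≡ g j → i ≡ j) where

    embed-injective : ∀ {x y} → embed g x ≡ embed g y → x ≡ y
    embed-injective {x} {y} eq = lookup-ext λ j → ≡.trans (≡.sym (lookup-embed g inj x j))
      (≡.trans (≡.cong (λ z → lookup z (g j)) eq) (lookup-embed g inj y j))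

    restrict-factor : ∀ {x y z} → embed g x ≡ y ⊕ z → ∃ λ y′ → y ≡ embed g y′
    restrict-factor {x} {y} {z} eq = y′ , lookup-ext go
      where
      y′ = tabulate (λ j → lookup y (g j))
      go : ∀ i → lookup y i ≡ lookup (embed g y′) i
      go i with Fin.any? (λ j → i Fin.≟ g j)
      ... | yes (j , ≡.refl) = ≡.sym (≡.trans (lookup-embed g inj y′ j) (lookup∘tabulate _ j))
      ... | no none = ≡.trans
        (m+n≡0⇒m≡0 _ (≡.trans (≡.sym (⊕-lookup y z i)) (≡.trans (≡.cong (λ w → lookup w i) (≡.sym eq)) (lookup-embed-∉ g x i∉g))))
        (≡.sym (lookup-embed-∉ g y′ i∉g))
        where i∉g = λ j i≡gj → none (j , i≡gj)

    split-embed : ∀ {x y z} → embed g x ≡ y ⊕ z → ∃₂ λ y′ z′ → y ≡ embed g y′ × z ≡ embed g z′ × x ≡ y′ ⊕ z′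
    split-embed {x} {y} {z} eq with restrict-factor {x} {y} {z} eq | restrict-factor {x} {z} {y} (≡.trans eq (⊕.comm y z))
    ... | y′ , ≡.refl | z′ , ≡.refl = y′ , z′ , ≡.refl , ≡.refl , embed-injective (≡.trans eq (≡.sym (embed-⊕ g y′ z′)))

module Transport {c ℓ} (G : AbelianGroup c ℓ) (n : ℕ) (e : FiniteEnum G n)
                 {k : ℕ} (g : Fin k → Fin n) (inj : ∀ {i j} → g i ≡ g j → i ≡ j) where
  open Finite G n e

  private
    M = IsPMZeroSum G (el ∘ g)

  value-embed : ∀ {k} (g : Fin k → Fin n) x → value el (embed g x) ≈ value (el ∘ g) x
  value-embed g []      = value-𝟙 el
  value-embed g (a ∷ x) = trans (value-⊕ el (single (g zero) a) _) (∙-cong (value-single el (g zero) a) (value-embed (g ∘ suc) x))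

  M⇒H : ∀ {x} → M x → H (embed g x)
  M⇒H Mx with M-elim Mx
  ... | p , q , ≡.refl , pq = ≡.subst H (≡.sym (embed-⊕ g p q))
    (M-intro (embed g p) (embed g q) (trans (value-embed g p) (trans pq (sym (value-embed g q)))))

  H⇒M : ∀ {x} → H (embed g x) → M x
  H⇒M Hx with M-elim Hx
  ... | p , q , eq , pq with split-embed g inj (≡.sym eq)
  ... | p′ , q′ , ≡.refl , ≡.refl , ≡.refl = M-intro p′ q′ (trans (sym (value-embed g p′)) (trans pq (value-embed g q′)))

  embed≡𝟙 : ∀ {x} → embed g x ≡ 𝟙 → x ≡ 𝟙
  embed≡𝟙 eq = embed-injective g inj (≡.trans eq (≡.sym (embed-𝟙 g)))

  M-atom⇒H-atom : ∀ {x} → IsAtom M x → IsAtom H (embed g x)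
  M-atom⇒H-atom {x} (Mx , x≢𝟙 , split) = M⇒H Mx , x≢𝟙 ∘ embed≡𝟙 , go
    where
    go : ∀ y z → H y → H z → embed g x ≡ y ⊕ z → (y ≡ 𝟙) ⊎ (z ≡ 𝟙)
    go y z Hy Hz eq with split-embed g inj {x} {y} {z} eq
    ... | y′ , z′ , ≡.refl , ≡.refl , eq′ with split y′ z′ (H⇒M Hy) (H⇒M Hz) eq′
    ... | inj₁ ≡.refl = inj₁ (embed-𝟙 g)
    ... | inj₂ ≡.refl = inj₂ (embed-𝟙 g)

  H-atom⇒M-atom : ∀ {x} → IsAtom H (embed g x) → IsAtom M x
  H-atom⇒M-atom {x} (Hx , x≢𝟙 , split) = H⇒M Hx , (λ { ≡.refl → x≢𝟙 (embed-𝟙 g) }) , go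
    where
    go : ∀ y z → M y → M z → x ≡ y ⊕ z → (y ≡ 𝟙) ⊎ (z ≡ 𝟙)
    go y z My Mz eq with split (embed g y) (embed g z) (M⇒H My) (M⇒H Mz) (≡.trans (≡.cong (embed g) eq) (embed-⊕ g y z))
    ... | inj₁ y≡𝟙 = inj₁ (embed≡𝟙 y≡𝟙)
    ... | inj₂ z≡𝟙 = inj₂ (embed≡𝟙 z≡𝟙)

  InL-M⇒H : ∀ {x l} → InL M x l → InL H (embed g x) l
  InL-M⇒H (as , ≡.refl , ats , ≡.refl) = go ats
    where
    go : ∀ {as} → All (IsAtom M) as → InL H (embed g (sumSeq as)) (length as)
    go []                  = ≡.subst (λ x → InL H x 0) (≡.sym (embed-𝟙 g)) InL-𝟙
    go {a ∷ as} (at ∷ ats) = ≡.subst (λ x → InL H x (suc (length as))) (≡.sym (embed-⊕ g a (sumSeq as)))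
      (InL-⊕ (InL-atom (M-atom⇒H-atom at)) (go ats))

  InL-H⇒M : ∀ {x l} → InL H (embed g x) l → InL M x l
  InL-H⇒M (as , ≡.refl , ats , eq) = go as ats eq
    where
    go : ∀ as → All (IsAtom H) as → ∀ {x} → embed g x ≡ sumSeq as → InL M x (length as)
    go []       []         eq = ≡.subst (λ x → InL M x 0) (≡.sym (embed≡𝟙 eq)) InL-𝟙
    go (a ∷ as) (at ∷ ats) {x} eq with split-embed g inj {x} {a} {sumSeq as} eq
    ... | y , z , ≡.refl , eq′ , ≡.refl = InL-⊕ (InL-atom (H-atom⇒M-atom at)) (go as ats (≡.sym eq′))

  -- This is `B±(G₀)` for the subset `G₀` of the elements `el (g j)`, viewed inside `H`.
  Supported : Seq n → Set ℓ
  Supported x = H x × ∃ λ y → x ≡ embed g y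

  supported-divisorClosed : DivisorClosed H Supported
  supported-divisorClosed = record
    { sub = λ _ → proj₁
    ; unit = M-𝟙 , 𝟙 , ≡.sym (embed-𝟙 g)
    ; closed = λ { x y (Hx , x′ , ≡.refl) (Hy , y′ , ≡.refl) → M-⊕ x Hx y Hy , x′ ⊕ y′ , ≡.sym (embed-⊕ g x′ y′) }
    ; divisors = λ { x y z (_ , x′ , ≡.refl) Hy _ eq → Hy , restrict-factor g inj {x′} {y} {z} eq } }

-- From configurations to Δ* and Δ₁

module _ {c ℓ} (G : AbelianGroup c ℓ) (n : ℕ) (e : FiniteEnum G n)
         {k : ℕ} (g : Fin (suc k) → Fin n) {d : ℕ} (C : Configuration G (Bijection.to e ∘ g) d) where
  open Finite G n e using (H; el; M-⊕; M-𝟙; M-double; reflexive)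
  open Configuration C
  open ConfigurationLengths G C
  open Transport G n e g (configuration-injective ∘ reflexive ∘ ≡.cong el)

  -- All differences of lengths over the configuration are multiples of `d`. So 2 and `2 + d` are
  -- adjacent lengths of `V₀²`, and no distance is smaller.
  configuration⇒Δ* : InΔ* H d
  configuration⇒Δ* = Supported , supported-divisorClosed ,
    (embed g (V₀ ⊕ V₀) , S-square , 0<d , 2 , H⇒S special-square-2 , H⇒S special-square-2+d , between) , minimal
    where
    S-square : Supported (embed g (V₀ ⊕ V₀))
    S-square = M⇒H (M-double {f = el ∘ g} V₀) , V₀ ⊕ V₀ , ≡.refl
    H⇒S : ∀ {l} → InL (IsPMZeroSum G (el ∘ g)) (V₀ ⊕ V₀) l → InL Supported (embed g (V₀ ⊕ V₀)) l
    H⇒S = InL-H⇒S supported-divisorClosed (M-⊕ {f = el}) (M-𝟙 {f = el}) S-square ∘ InL-M⇒H {V₀ ⊕ V₀}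
    difference : ∀ {x l δ} → Supported x → InL Supported x l → InL Supported x (l + δ) → d ∣ δ
    difference (_ , y , ≡.refl) Ll Lδ = d∣differences (S⇒M {y} Ll) (S⇒M {y} Lδ)
      where
      S⇒M : ∀ {y l} → InL Supported (embed g y) l → InL (IsPMZeroSum G (el ∘ g)) y l
      S⇒M {y} = InL-H⇒M {y} ∘ InL-S⇒H supported-divisorClosed
    d≤difference : ∀ {x l δ} → 0 < δ → Supported x → InL Supported x l → InL Supported x (l + δ) → d ≤ δ
    d≤difference 0<δ Sx Ll Lδ = ∣⇒≤ ⦃ >-nonZero 0<δ ⦄ (difference Sx Ll Lδ)
    between : ∀ m → 2 < m → m < 2 + d → ¬ InL Supported (embed g (V₀ ⊕ V₀)) m
    between (suc (suc δ)) (s≤s (s≤s 0<δ)) (s≤s (s≤s δ<d)) Lm =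
      <⇒≱ δ<d (d≤difference 0<δ S-square (H⇒S special-square-2) Lm)
    minimal : ∀ d′ → InΔ Supported d′ → d ≤ d′
    minimal d′ (_ , Sx , 0<d′ , l , Ll , Lld′ , _) = d≤difference 0<d′ Sx Ll Lld′

  -- The lengths of `power r` from `2r` to `2r + rd` are congruent to `2r` modulo `d`, and all
  -- candidates occur by `power-lengths`.
  configuration⇒Δ₁ : InΔ₁ H d
  configuration⇒Δ₁ = 0<d , λ r → embed g (power r) , M⇒H (power∈M r) , r * 2 , InL-M⇒H {power r} (base r) ,
    λ m l≤m m≤ → in-progression r m l≤m m≤ , λ { j j≤r ≡.refl → InL-M⇒H {power r} (power-lengths r j j≤r) }
    where
    power∈M : ∀ r → IsPMZeroSum G (el ∘ g) (power r)
    power∈M zero    = M-𝟙 {f = el ∘ g}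
    power∈M (suc r) = M-⊕ {f = el ∘ g} _ (M-double {f = el ∘ g} V₀) _ (power∈M r)
    base : ∀ r → InL (IsPMZeroSum G (el ∘ g)) (power r) (r * 2)
    base r = ≡.subst (InL _ (power r)) (+-identityʳ (r * 2)) (power-lengths r 0 z≤n)
    in-progression : ∀ r m → r * 2 ≤ m → m ≤ r * 2 + r * d → InL H (embed g (power r)) m → ∃ λ j → j ≤ r × m ≡ r * 2 + j * d
    in-progression r m l≤m m≤ Lm with m ∸ r * 2 | m+[n∸m]≡n l≤m
    ... | δ | ≡.refl with d∣differences (base r) (InL-H⇒M {power r} Lm)
    ... | divides j ≡.refl = j , *-cancelʳ-≤ j r d ⦃ >-nonZero 0<d ⦄ (+-cancelˡ-≤ (r * 2) _ _ m≤) , ≡.refl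

-- The four configurations

halve : ∀ m → (∃ λ h → m ≡ h + h) ⊎ (∃ λ h → m ≡ suc (h + h))
halve zero    = inj₁ (0 , ≡.refl)
halve (suc m) with halve m
... | inj₁ (h , ≡.refl) = inj₂ (h , ≡.refl)
... | inj₂ (h , ≡.refl) = inj₁ (suc h , ≡.cong suc (≡.sym (+-suc h h)))

module Configurations {c ℓ} (G : AbelianGroup c ℓ) where
  open PlusMinus G
  open import Relation.Binary.Reasoning.Setoid setoid
  open import Algebra.Properties.CommutativeSemigroup commutativeSemigroup using (interchange)

  even-multiple : ∀ {a} → a ∙ a ≈ ε → ∀ m → (m + m) · a ≈ ε
  even-multiple {a} aa≈ε m = begin
    (m + m) · a     ≈⟨ ×-homo-+ a m m ⟩
    m · a ∙ m · a   ≈⟨ ×-distrib-+ a a m ⟨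
    m · (a ∙ a)     ≈⟨ ·-annihilated m aa≈ε ⟩
    ε               ∎

  odd-multiple : ∀ {a} → a ∙ a ≈ ε → ∀ m → suc (m + m) · a ≈ a
  odd-multiple aa≈ε m = trans (∙-congˡ (even-multiple aa≈ε m)) (identityʳ _)

  order2-inverse : ∀ {a x} → a ∙ a ≈ ε → a ∙ x ≈ ε → x ≈ a
  order2-inverse aa≈ε ax≈ε = ∙-cancelˡ _ _ _ (trans ax≈ε (sym aa≈ε))

  ·-comm : ∀ m n a → m · (n · a) ≈ n · (m · a)
  ·-comm m n a = trans (×-assocˡ a m n) (trans (reflexive (≡.cong (_· a) (*-comm m n))) (sym (×-assocˡ a n m)))

  -- The two signed parts have equal values, so the value of `x` is a double. The classifications
  -- use only this and, through `q ⊕ r ≡ x`, that `q` is bounded by `x`.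
  M-elim₂ : ∀ {n} {f : Fin n → Carrier} {x} → IsPMZeroSum G f x → ∃₂ λ q r → q ⊕ r ≡ x × value f x ≈ value f q ∙ value f q
  M-elim₂ {f = f} Mx with M-elim Mx
  ... | p , q , ≡.refl , pq = p , q , ≡.refl , trans (value-⊕ f p q) (∙-congˡ (sym pq))

  module OddOrder (f : Fin 2 → Carrier) (m : ℕ)
    (a≉ε : ¬ f 0F ≈ ε) (aa≈ε : f 0F ∙ f 0F ≈ ε) (0<m : 0 < m) (rb≈a : suc (m + m) · f 1F ≈ f 0F)
    (minimal : ∀ m′ → suc (m′ + m′) · f 1F ≈ f 0F → m ≤ m′) where

    private
      a = f 0F
      b = f 1F

    r : ℕ
    r = suc (m + m)

    V : Seq 2
    V = 1 ∷ r ∷ []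

    r·multiple : ∀ j → r · (j · b) ≈ j · a
    r·multiple j = trans (·-comm r j b) (×-congʳ j rb≈a)


    reduced : ∀ i j q₀ q₁ → i · a ∙ (j · b ∙ ε) ≈ (q₀ · a ∙ (q₁ · b ∙ ε)) ∙ (q₀ · a ∙ (q₁ · b ∙ ε)) → i · a ∙ j · b ≈ (q₁ + q₁) · b
    reduced i j q₀ q₁ eq = begin
      i · a ∙ j · b                               ≈⟨ ∙-congˡ (identityʳ _) ⟨
      i · a ∙ (j · b ∙ ε)                         ≈⟨ eq ⟩
      (q₀ · a ∙ (q₁ · b ∙ ε)) ∙ (q₀ · a ∙ (q₁ · b ∙ ε)) ≈⟨ ∙-cong (∙-congˡ (identityʳ _)) (∙-congˡ (identityʳ _)) ⟩
      (q₀ · a ∙ q₁ · b) ∙ (q₀ · a ∙ q₁ · b)       ≈⟨ interchange _ _ _ _ ⟩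
      (q₀ · a ∙ q₀ · a) ∙ (q₁ · b ∙ q₁ · b)       ≈⟨ ∙-cong (sym (×-homo-+ a q₀ q₀)) (sym (×-homo-+ b q₁ q₁)) ⟩
      (q₀ + q₀) · a ∙ (q₁ + q₁) · b               ≈⟨ ∙-congʳ (even-multiple aa≈ε q₀) ⟩
      ε ∙ (q₁ + q₁) · b                           ≈⟨ identityˡ _ ⟩
      (q₁ + q₁) · b                               ∎

    -- Multiply by `r`: being odd it fixes `a`, and it takes `b` to `a`.
    same-parity : ∀ i j q → i · a ∙ j · b ≈ (q + q) · b → (i + j) · a ≈ ε
    same-parity i j q eq = begin
      (i + j) · a                 ≈⟨ ×-homo-+ a i j ⟩
      i · a ∙ j · a               ≈⟨ ∙-cong (×-congʳ i (odd-multiple aa≈ε m)) (r·multiple j) ⟨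
      i · (r · a) ∙ r · (j · b)   ≈⟨ ∙-congʳ (·-comm i r a) ⟩
      r · (i · a) ∙ r · (j · b)   ≈⟨ ×-distrib-+ _ _ r ⟨
      r · (i · a ∙ j · b)         ≈⟨ ×-congʳ r eq ⟩
      r · ((q + q) · b)           ≈⟨ r·multiple (q + q) ⟩
      (q + q) · a                 ≈⟨ even-multiple aa≈ε q ⟩
      ε                           ∎

    -- Since `a = -a`, the equation makes `a` the multiple of `b` by the odd number `|2h + 1 - 2q|`.
    -- As `0 ≤ q ≤ 2h + 1`, this is at most `2h + 1`, and minimality of `r` applies. The two cases
    -- are the two signs.
    minimal-≤ : ∀ h q → q ≤ suc (h + h) → a ∙ suc (h + h) · b ≈ (q + q) · b → m ≤ h
    minimal-≤ h q q≤ eq with q ≤? h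
    ... | yes q≤h = ≤-trans (minimal (h ∸ q) (order2-inverse aa≈ε (∙-cancelʳ ((q + q) · b) _ _ (begin
        a ∙ suc (t + t) · b ∙ (q + q) · b   ≈⟨ assoc a _ _ ⟩
        a ∙ (suc (t + t) · b ∙ (q + q) · b) ≈⟨ ∙-congˡ (×-homo-+ b (suc (t + t)) (q + q)) ⟨
        a ∙ (suc (t + t) + (q + q)) · b     ≡⟨ ≡.cong (λ s → a ∙ suc s · b) (≡.trans (solve 2 (λ t q → t :+ t :+ (q :+ q) := t :+ q :+ (t :+ q)) ≡.refl t q) (≡.cong₂ _+_ (m∸n+n≡m q≤h) (m∸n+n≡m q≤h))) ⟩
        a ∙ suc (h + h) · b                 ≈⟨ eq ⟩
        (q + q) · b                         ≈⟨ identityˡ _ ⟨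
        ε ∙ (q + q) · b                     ∎)))) (m∸n≤m h q)
      where
      t = h ∸ q
      open +-*-Solver
    ... | no q≰h with q ∸ suc h | m+[n∸m]≡n (≰⇒> q≰h)
    ... | t | ≡.refl = ≤-trans (minimal t (sym (∙-cancelʳ (suc (h + h) · b) _ _ (begin
        a ∙ suc (h + h) · b                 ≈⟨ eq ⟩
        (suc h + t + (suc h + t)) · b       ≡⟨ ≡.cong (_· b) (solve 2 (λ h t → con 1 :+ h :+ t :+ (con 1 :+ h :+ t) := con 1 :+ (t :+ t) :+ (con 1 :+ (h :+ h))) ≡.refl h t) ⟩
        (suc (t + t) + suc (h + h)) · b     ≈⟨ ×-homo-+ b (suc (t + t)) (suc (h + h)) ⟩
        suc (t + t) · b ∙ suc (h + h) · b   ∎)))) (+-cancelˡ-≤ (suc h) t h q≤)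
      where open +-*-Solver

    classify : ∀ x → IsPMZeroSum G f x → (∃ λ y → x ≡ y ⊕ y) ⊎ (∃ λ y → x ≡ V ⊕ (y ⊕ y))
    classify (i ∷ j ∷ []) Mx with M-elim₂ {f = f} Mx
    ... | q₀ ∷ q₁ ∷ [] , r₀ ∷ r₁ ∷ [] , eq , sum≈ with reduced i j q₀ q₁ sum≈
    ... | red with same-parity i j q₁ red | halve i | halve j
    ... | _ | inj₁ (i′ , ≡.refl) | inj₁ (j′ , ≡.refl) = inj₁ (i′ ∷ j′ ∷ [] , ≡.refl)
    ... | s | inj₁ (i′ , ≡.refl) | inj₂ (j′ , ≡.refl) = contradiction (trans (sym (trans (×-homo-+ a (i′ + i′) (suc (j′ + j′))) (trans (∙-cong (even-multiple aa≈ε i′) (odd-multiple aa≈ε j′)) (identityˡ a)))) s) a≉ε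
    ... | s | inj₂ (i′ , ≡.refl) | inj₁ (j′ , ≡.refl) = contradiction (trans (sym (trans (×-homo-+ a (suc (i′ + i′)) (j′ + j′)) (trans (∙-cong (odd-multiple aa≈ε i′) (even-multiple aa≈ε j′)) (identityʳ a)))) s) a≉ε
    ... | _ | inj₂ (i′ , ≡.refl) | inj₂ (j′ , ≡.refl) = inj₂ (i′ ∷ j′ ∸ m ∷ [] , ≡.cong₂ (λ i j → suc i ∷ suc j ∷ []) ≡.refl
        (≡.trans (≡.cong₂ _+_ (≡.sym (m+[n∸m]≡n m≤j′)) (≡.sym (m+[n∸m]≡n m≤j′))) (solve 2 (λ m t → m :+ t :+ (m :+ t) := m :+ m :+ (t :+ t)) ≡.refl m (j′ ∸ m))))
      where
      open +-*-Solver
      m≤j′ : m ≤ j′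
      m≤j′ = minimal-≤ j′ q₁ (≤-trans (m≤m+n q₁ r₁) (≤-reflexive (≡.cong (Data.Vec.head ∘ Data.Vec.tail) eq)))
        (trans (∙-congʳ (sym (odd-multiple aa≈ε i′))) red)

    MV : IsPMZeroSum G f V
    MV = M-intro {f = f} (1 ∷ 0 ∷ []) (0 ∷ r ∷ []) (begin
      a ∙ ε ∙ (ε ∙ ε)     ≈⟨ ∙-cong (identityʳ a) (identityʳ ε) ⟩
      a ∙ ε               ≈⟨ ∙-congʳ rb≈a ⟨
      r · b ∙ ε           ≈⟨ identityˡ _ ⟨
      ε ∙ (r · b ∙ ε)     ∎)

    b≉ε : ¬ b ≈ ε
    b≉ε b≈ε = a≉ε (trans (sym rb≈a) (·-annihilated r b≈ε))

    configuration : Configuration G f (m + m)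
    configuration = record
      { 0<d = ≤-trans 0<m (m≤m+n m m)
      ; nonzero = λ { zero → a≉ε ; 1F → b≉ε }
      ; V₀ = V
      ; special = special
      ; classify = λ x Mx → case classify x Mx of λ
          { (inj₁ even) → inj₁ even ; (inj₂ (y , eq)) → inj₂ (V , y , special , eq) } }
      where
      special : Special G f (m + m) V
      special = MV , ≡.cong (λ s → suc (suc s)) (+-identityʳ (m + m)) , 0 , ≡.refl

  module Order8 (f : Fin 2 → Carrier) 
    (f₁≈3k : f 1F ≈ 3 · f 0F) (8k≈ε : 8 · f 0F ≈ ε) (4k≉ε : ¬ 4 · f 0F ≈ ε) where

    private
      k = f 0F

    as-multiple : ∀ i j → i · k ∙ (j · f 1F ∙ ε) ≈ (i + j * 3) · k
    as-multiple i j = begin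
      i · k ∙ (j · f 1F ∙ ε) ≈⟨ ∙-congˡ (trans (identityʳ _) (×-congʳ j f₁≈3k)) ⟩
      i · k ∙ j · (3 · k)            ≈⟨ ∙-congˡ (×-assocˡ k j 3) ⟩
      i · k ∙ (j * 3) · k            ≈⟨ ×-homo-+ k i (j * 3) ⟨
      (i + j * 3) · k                ∎

    2k≉ε : ¬ 2 · k ≈ ε
    2k≉ε 2k≈ε = 4k≉ε (trans (×-homo-+ k 2 2) (trans (∙-cong 2k≈ε 2k≈ε) (identityˡ ε)))

    -- Multiplication by 4 turns the left side into `4k` and the right side into a multiple of `8k`.
    -- Hence both multiplicities have the same parity.
    odd-multiple≉double : ∀ t Q → ¬ suc (t + t) · k ≈ Q · k ∙ Q · k
    odd-multiple≉double t Q eq = 4k≉ε (begin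
      4 · k                       ≈⟨ identityʳ _ ⟨
      4 · k ∙ ε                   ≈⟨ ∙-congˡ (·-annihilated t 8k≈ε) ⟨
      4 · k ∙ t · (8 · k)         ≈⟨ ∙-congˡ (×-assocˡ k t 8) ⟩
      4 · k ∙ (t * 8) · k         ≈⟨ ×-homo-+ k 4 (t * 8) ⟨
      (4 + t * 8) · k             ≡⟨ ≡.cong (_· k) (solve 1 (λ t → con 4 :+ t :* con 8 := con 4 :* (con 1 :+ (t :+ t))) ≡.refl t) ⟩
      (4 * suc (t + t)) · k       ≈⟨ ×-assocˡ k 4 (suc (t + t)) ⟨
      4 · (suc (t + t) · k)       ≈⟨ ×-congʳ 4 eq ⟩
      4 · (Q · k ∙ Q · k)         ≈⟨ ×-congʳ 4 (×-homo-+ k Q Q) ⟨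
      4 · ((Q + Q) · k)           ≈⟨ ×-assocˡ k 4 (Q + Q) ⟩
      (4 * (Q + Q)) · k           ≡⟨ ≡.cong (_· k) (solve 1 (λ t → con 4 :* (t :+ t) := t :* con 8) ≡.refl Q) ⟩
      (Q * 8) · k                 ≈⟨ ×-assocˡ k Q 8 ⟨
      Q · (8 · k)                 ≈⟨ ·-annihilated Q 8k≈ε ⟩
      ε                           ∎)
      where open +-*-Solver

    -- This excludes the sequence `k (3k)`, the only one with odd multiplicities that contains
    -- neither `V₁` nor `V₃` up to squares: the doubles are 0, `2k`, `6k` and `8k`.
    4≉double : ∀ q₀ q₁ → q₀ ≤ 1 → q₁ ≤ 1 → ¬ 4 · k ≈ (q₀ + q₁ * 3) · k ∙ (q₀ + q₁ * 3) · k
    4≉double 0 0 _ _ eq = 4k≉ε (trans eq (identityˡ ε))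
    4≉double 1 0 _ _ eq = 2k≉ε (∙-cancelˡ (1 · k ∙ 1 · k) _ _ (begin
      (1 · k ∙ 1 · k) ∙ 2 · k ≈⟨ ∙-congʳ (×-homo-+ k 1 1) ⟨
      2 · k ∙ 2 · k           ≈⟨ ×-homo-+ k 2 2 ⟨
      4 · k                   ≈⟨ eq ⟩
      1 · k ∙ 1 · k           ≈⟨ identityʳ _ ⟨
      1 · k ∙ 1 · k ∙ ε       ∎))
    4≉double 0 1 _ _ eq = 2k≉ε (∙-cancelˡ (4 · k) _ _ (begin
      4 · k ∙ 2 · k           ≈⟨ ×-homo-+ k 4 2 ⟨
      6 · k                   ≈⟨ ×-homo-+ k 3 3 ⟩
      3 · k ∙ 3 · k           ≈⟨ eq ⟨
      4 · k                   ≈⟨ identityʳ _ ⟨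
      4 · k ∙ ε               ∎))
    4≉double 1 1 _ _ eq = 4k≉ε (trans eq (trans (sym (×-homo-+ k 4 4)) 8k≈ε))
    4≉double (suc (suc _)) _ (s≤s ()) _ _
    4≉double _ (suc (suc _)) _ (s≤s ()) _

    V₁ V₃ : Seq 2
    V₁ = 1 ∷ 3 ∷ []
    V₃ = 3 ∷ 1 ∷ []

    special₁ : Special G f 2 V₁
    special₁ = M-intro {f = f} (1 ∷ 0 ∷ []) (0 ∷ 3 ∷ []) (begin
      value f (1 ∷ 0 ∷ [])  ≈⟨ as-multiple 1 0 ⟩
      1 · k                 ≈⟨ identityʳ _ ⟨
      1 · k ∙ ε             ≈⟨ ∙-congˡ 8k≈ε ⟨
      1 · k ∙ 8 · k         ≈⟨ ×-homo-+ k 1 8 ⟨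
      9 · k                 ≈⟨ as-multiple 0 3 ⟨
      value f (0 ∷ 3 ∷ [])  ∎) , ≡.refl , 0 , ≡.refl

    special₃ : Special G f 2 V₃
    special₃ = M-intro {f = f} (3 ∷ 0 ∷ []) (0 ∷ 1 ∷ []) (trans (as-multiple 3 0) (sym (as-multiple 0 1))) , ≡.refl , 1 , ≡.refl

    classify : ∀ x → IsPMZeroSum G f x → (∃ λ y → x ≡ y ⊕ y) ⊎ (∃₂ λ V y → Special G f 2 V × x ≡ V ⊕ (y ⊕ y))
    classify (i ∷ j ∷ []) Mx with M-elim₂ {f = f} Mx
    ... | q₀ ∷ q₁ ∷ [] , r₀ ∷ r₁ ∷ [] , eq , sum≈
      with trans (sym (as-multiple i j)) (trans sum≈ (∙-cong (as-multiple q₀ q₁) (as-multiple q₀ q₁))) | halve i | halve j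
    ... | _ | inj₁ (i′ , ≡.refl) | inj₁ (j′ , ≡.refl) = inj₁ (i′ ∷ j′ ∷ [] , ≡.refl)
    ... | s | inj₁ (i′ , ≡.refl) | inj₂ (j′ , ≡.refl) = contradiction
      (trans (reflexive (≡.cong (_· k) (solve 2 (λ i j → con 1 :+ (i :+ j :* con 3 :+ con 1 :+ (i :+ j :* con 3 :+ con 1)) := i :+ i :+ (con 1 :+ (j :+ j)) :* con 3) ≡.refl i′ j′))) s)
      (odd-multiple≉double (i′ + j′ * 3 + 1) (q₀ + q₁ * 3))
      where open +-*-Solver
    ... | s | inj₂ (i′ , ≡.refl) | inj₁ (j′ , ≡.refl) = contradiction
      (trans (reflexive (≡.cong (_· k) (solve 2 (λ i j → con 1 :+ (i :+ j :* con 3 :+ (i :+ j :* con 3)) := con 1 :+ (i :+ i) :+ (j :+ j) :* con 3) ≡.refl i′ j′))) s)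
      (odd-multiple≉double (i′ + j′ * 3) (q₀ + q₁ * 3))
      where open +-*-Solver
    ... | _ | inj₂ (suc i′ , ≡.refl) | inj₂ (j′ , ≡.refl) =
      inj₂ (V₃ , i′ ∷ j′ ∷ [] , special₃ , ≡.cong (λ i → suc (suc i) ∷ suc (j′ + j′) ∷ []) (+-suc i′ i′))
    ... | _ | inj₂ (i′ , ≡.refl) | inj₂ (suc j′ , ≡.refl) =
      inj₂ (V₁ , i′ ∷ j′ ∷ [] , special₁ , ≡.cong (λ j → suc (i′ + i′) ∷ suc (suc j) ∷ []) (+-suc j′ j′))
    ... | s | inj₂ (0 , ≡.refl) | inj₂ (0 , ≡.refl) = contradiction s (4≉double q₀ q₁
      (≤-trans (m≤m+n q₀ r₀) (≤-reflexive (≡.cong Data.Vec.head eq)))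
      (≤-trans (m≤m+n q₁ r₁) (≤-reflexive (≡.cong (Data.Vec.head ∘ Data.Vec.tail) eq))))

    f₁≉ε : ¬ f 1F ≈ ε
    f₁≉ε f₁≈ε = 4k≉ε (∙-cancelˡ (8 · k) _ _ (begin
      8 · k ∙ 4 · k       ≈⟨ ×-homo-+ k 8 4 ⟨
      12 · k              ≈⟨ ×-assocˡ k 4 3 ⟨
      4 · (3 · k)         ≈⟨ ×-congʳ 4 f₁≈3k ⟨
      4 · f 1F    ≈⟨ ·-annihilated 4 f₁≈ε ⟩
      ε                   ≈⟨ 8k≈ε ⟨
      8 · k               ≈⟨ identityʳ _ ⟨
      8 · k ∙ ε           ∎))

    configuration : Configuration G f 2
    configuration = record
      { 0<d = s≤s z≤n
      ; nonzero = λ { zero k≈ε → 4k≉ε (·-annihilated 4 k≈ε) ; 1F → f₁≉ε }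
      ; V₀ = V₁ ; special = special₁ ; classify = classify }

  two-multiples : ∀ {a} → a ∙ a ≈ ε → ∀ m → m · a ≈ ε ⊎ m · a ≈ a
  two-multiples aa≈ε m with halve m
  ... | inj₁ (h , ≡.refl) = inj₁ (even-multiple aa≈ε h)
  ... | inj₂ (h , ≡.refl) = inj₂ (odd-multiple aa≈ε h)

  order2-∙ : ∀ {a b} → a ∙ a ≈ ε → b ∙ b ≈ ε → (a ∙ b) ∙ (a ∙ b) ≈ ε
  order2-∙ aa≈ε bb≈ε = trans (interchange _ _ _ _) (trans (∙-cong aa≈ε bb≈ε) (identityˡ ε))

  value-square : ∀ {n} (f : Fin n → Carrier) x → value f x ∙ value f x ≈ ∑ λ i → lookup x i · (f i ∙ f i)
  value-square {n} f x = sym $ trans (sum-cong-≋ {n} λ i → ×-distrib-+ (f i) (f i) (lookup x i)) (∑-distrib-+ {n} _ _)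

  module Exponent4 (f : Fin 3 → Carrier)
    (hh≈ε : f 0F ∙ f 0F ≈ ε) (h≉ε : ¬ f 0F ≈ ε) (h≉e : ¬ f 0F ≈ f 2F ∙ f 2F) (f₁≈he : f 1F ≈ f 0F ∙ (f 2F ∙ f 2F))
    (e≉ε : ¬ f 2F ∙ f 2F ≈ ε) (ee≈ε : (f 2F ∙ f 2F) ∙ (f 2F ∙ f 2F) ≈ ε) where

    private
      h = f 0F
      g = f 2F
      e = f 2F ∙ f 2F

    f₁f₁≈ε : f 1F ∙ f 1F ≈ ε
    f₁f₁≈ε = trans (∙-cong f₁≈he f₁≈he) (order2-∙ hh≈ε ee≈ε)

    -- Doubling kills `h` and `h + e`, so doubles of values are multiples of `e = 2g`.
    square : ∀ i j l → value f (i ∷ j ∷ l ∷ []) ∙ value f (i ∷ j ∷ l ∷ []) ≈ l · e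
    square i j l = begin
      value f (i ∷ j ∷ l ∷ []) ∙ value f (i ∷ j ∷ l ∷ [])     ≈⟨ value-square f (i ∷ j ∷ l ∷ []) ⟩
      i · (h ∙ h) ∙ (j · (f 1F ∙ f 1F) ∙ (l · e ∙ ε))         ≈⟨ ∙-cong (·-annihilated i hh≈ε) (∙-cong (·-annihilated j f₁f₁≈ε) (identityʳ _)) ⟩
      ε ∙ (ε ∙ l · e)                                         ≈⟨ trans (identityˡ _) (identityˡ _) ⟩
      l · e                                                   ∎

    double-multiple : ∀ l → (l + l) · g ≈ l · e
    double-multiple l = trans (×-homo-+ g l l) (sym (×-distrib-+ g g l))

    -- The multiples of `e` are 0 and `e`, and `h` is neither. This forces the multiplicities of `h`
    -- and `h + e` to have the same parity.
    h∉⟨e⟩ : ∀ s t → ¬ h ∙ s · e ≈ t · e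
    h∉⟨e⟩ s t eq with two-multiples ee≈ε s | two-multiples ee≈ε t
    ... | inj₁ s≈ | inj₁ t≈ = h≉ε (trans (sym (trans (∙-congˡ s≈) (identityʳ h))) (trans eq t≈))
    ... | inj₁ s≈ | inj₂ t≈ = h≉e (trans (sym (trans (∙-congˡ s≈) (identityʳ h))) (trans eq t≈))
    ... | inj₂ s≈ | inj₁ t≈ = h≉e (∙-cancelʳ e _ _ (trans (trans (sym (∙-congˡ s≈)) (trans eq t≈)) (sym ee≈ε)))
    ... | inj₂ s≈ | inj₂ t≈ = h≉ε (∙-cancelʳ e _ _ (trans (trans (sym (∙-congˡ s≈)) (trans eq t≈)) (sym (identityˡ e))))

    V : Seq 3
    V = 1 ∷ 1 ∷ 2 ∷ []

    classify : ∀ x → IsPMZeroSum G f x → (∃ λ y → x ≡ y ⊕ y) ⊎ (∃ λ y → x ≡ V ⊕ (y ⊕ y))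
    classify (i ∷ j ∷ l ∷ []) Mx with M-elim₂ {f = f} Mx
    ... | q₀ ∷ q₁ ∷ q₂ ∷ [] , r₀ ∷ r₁ ∷ r₂ ∷ [] , eq , sum≈ with trans sum≈ (square q₀ q₁ q₂) | halve i | halve j | halve l
    -- The value of `x` is a multiple of `e`, so its double vanishes; for odd `l` that double is
    -- `e`.
    ... | s | _ | _ | inj₂ (l′ , ≡.refl) = contradiction (begin
      e                        ≈⟨ odd-multiple ee≈ε l′ ⟨
      suc (l′ + l′) · e        ≈⟨ square i j (suc (l′ + l′)) ⟨
      X ∙ X                    ≈⟨ ∙-cong s s ⟩
      q₂ · e ∙ q₂ · e          ≈⟨ ×-distrib-+ e e q₂ ⟨
      q₂ · (e ∙ e)             ≈⟨ ·-annihilated q₂ ee≈ε ⟩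
      ε                        ∎) e≉ε
      where X = value f (i ∷ j ∷ suc (l′ + l′) ∷ [])
    ... | _ | inj₁ (i′ , ≡.refl) | inj₁ (j′ , ≡.refl) | inj₁ (l′ , ≡.refl) = inj₁ (i′ ∷ j′ ∷ l′ ∷ [] , ≡.refl)
    ... | s | inj₂ (i′ , ≡.refl) | inj₁ (j′ , ≡.refl) | inj₁ (l′ , ≡.refl) = contradiction (begin
      h ∙ l′ · e               ≈⟨ ∙-cong (odd-multiple hh≈ε i′) (trans (∙-cong (even-multiple f₁f₁≈ε j′) (trans (identityʳ _) (double-multiple l′))) (identityˡ _)) ⟨
      value f (suc (i′ + i′) ∷ j′ + j′ ∷ l′ + l′ ∷ []) ≈⟨ s ⟩
      q₂ · e                   ∎) (h∉⟨e⟩ l′ q₂)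
    ... | s | inj₁ (i′ , ≡.refl) | inj₂ (j′ , ≡.refl) | inj₁ (l′ , ≡.refl) = contradiction (begin
      h ∙ (e ∙ l′ · e)         ≈⟨ assoc h e _ ⟨
      h ∙ e ∙ l′ · e           ≈⟨ ∙-congʳ f₁≈he ⟨
      f 1F ∙ l′ · e            ≈⟨ identityˡ _ ⟨
      ε ∙ (f 1F ∙ l′ · e)      ≈⟨ ∙-cong (even-multiple hh≈ε i′) (∙-cong (odd-multiple f₁f₁≈ε j′) (trans (identityʳ _) (double-multiple l′))) ⟨
      value f (i′ + i′ ∷ suc (j′ + j′) ∷ l′ + l′ ∷ []) ≈⟨ s ⟩
      q₂ · e                   ∎) (h∉⟨e⟩ (suc l′) q₂)
    ... | _ | inj₂ (i′ , ≡.refl) | inj₂ (j′ , ≡.refl) | inj₁ (suc l′ , ≡.refl) =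
      inj₂ (i′ ∷ j′ ∷ l′ ∷ [] , ≡.cong (λ l → suc (i′ + i′) ∷ suc (j′ + j′) ∷ suc l ∷ []) (+-suc l′ l′))
    -- With no occurrence of `g` also `q₂ = 0`, and `h + (h + e) = e` would have to vanish.
    ... | s | inj₂ (i′ , ≡.refl) | inj₂ (j′ , ≡.refl) | inj₁ (0 , ≡.refl) = contradiction (begin
      e                        ≈⟨ identityˡ e ⟨
      ε ∙ e                    ≈⟨ ∙-congʳ hh≈ε ⟨
      h ∙ h ∙ e                ≈⟨ assoc h h e ⟩
      h ∙ (h ∙ e)              ≈⟨ ∙-congˡ (trans (∙-congˡ (identityˡ ε)) (trans (identityʳ _) f₁≈he)) ⟨
      h ∙ (f 1F ∙ (ε ∙ ε))     ≈⟨ ∙-cong (odd-multiple hh≈ε i′) (∙-congʳ (odd-multiple f₁f₁≈ε j′)) ⟨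
      value f (suc (i′ + i′) ∷ suc (j′ + j′) ∷ 0 ∷ []) ≈⟨ s ⟩
      q₂ · e                   ≡⟨ ≡.cong (_· e) (m+n≡0⇒m≡0 q₂ (≡.cong (Data.Vec.head ∘ Data.Vec.tail ∘ Data.Vec.tail) eq)) ⟩
      ε                        ∎) e≉ε

    configuration : Configuration G f 2
    configuration = record
      { 0<d = s≤s z≤n
      ; nonzero = λ
          { 0F → h≉ε
          ; 1F f₁≈ε → h≉e (∙-cancelʳ e _ _ (trans (sym f₁≈he) (trans f₁≈ε (sym ee≈ε))))
          ; 2F g≈ε → e≉ε (trans (∙-cong g≈ε g≈ε) (identityˡ ε)) }
      ; V₀ = V
      ; special = special
      ; classify = λ x Mx → case classify x Mx of λ
          { (inj₁ even) → inj₁ even ; (inj₂ (y , eq)) → inj₂ (V , y , special , eq) } }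
      where
      special : Special G f 2 V
      special = M-intro {f = f} (1 ∷ 0 ∷ 2 ∷ []) (0 ∷ 1 ∷ 0 ∷ []) (begin
        1 · h ∙ (ε ∙ (2 · g ∙ ε))   ≈⟨ ∙-cong (×-homo-1 h) (trans (identityˡ _) (trans (identityʳ _) (∙-congˡ (identityʳ g)))) ⟩
        h ∙ e                       ≈⟨ f₁≈he ⟨
        f 1F                        ≈⟨ ×-homo-1 (f 1F) ⟨
        1 · f 1F                    ≈⟨ trans (identityˡ _) (trans (∙-congˡ (identityʳ ε)) (identityʳ _)) ⟨
        ε ∙ (1 · f 1F ∙ (ε ∙ ε))    ∎) , ≡.refl , 0 , ≡.refl

  module Exponent2 (f : Fin 4 → Carrier) (exponent : ∀ i → f i ∙ f i ≈ ε) (f₀≈ : f 0F ≈ f 1F ∙ f 2F ∙ f 3F)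
    (a≉ε : ¬ f 1F ≈ ε) (b≉ε : ¬ f 2F ≈ ε) (b≉a : ¬ f 2F ≈ f 1F)
    (c≉ε : ¬ f 3F ≈ ε) (c≉a : ¬ f 3F ≈ f 1F) (c≉b : ¬ f 3F ≈ f 2F) (c≉ab : ¬ f 3F ≈ f 1F ∙ f 2F) where

    private
      a = f 1F
      b = f 2F
      c′ = f 3F

    -- Modulo 2 there are seven nonzero coefficient vectors; each contradicts one of the seven
    -- hypotheses on `a`, `b`, `c`.
    independent : ∀ s t u → s · a ∙ (t · b ∙ u · c′) ≈ ε →
      (∃ λ s′ → s ≡ s′ + s′) × (∃ λ t′ → t ≡ t′ + t′) × (∃ λ u′ → u ≡ u′ + u′)
    independent s t u eq with halve s | halve t | halve u
    ... | inj₁ s-even | inj₁ t-even | inj₁ u-even = s-even , t-even , u-even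
    ... | inj₁ (s′ , ≡.refl) | inj₁ (t′ , ≡.refl) | inj₂ (u′ , ≡.refl) = contradiction
      (trans (sym (trans (∙-cong (even-multiple (exponent 1F) s′) (∙-cong (even-multiple (exponent 2F) t′) (odd-multiple (exponent 3F) u′))) (trans (identityˡ _) (identityˡ _)))) eq) c≉ε
    ... | inj₁ (s′ , ≡.refl) | inj₂ (t′ , ≡.refl) | inj₁ (u′ , ≡.refl) = contradiction
      (trans (sym (trans (∙-cong (even-multiple (exponent 1F) s′) (∙-cong (odd-multiple (exponent 2F) t′) (even-multiple (exponent 3F) u′))) (trans (identityˡ _) (identityʳ _)))) eq) b≉ε
    ... | inj₁ (s′ , ≡.refl) | inj₂ (t′ , ≡.refl) | inj₂ (u′ , ≡.refl) = contradiction (order2-inverse (exponent 2F)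
      (trans (sym (trans (∙-cong (even-multiple (exponent 1F) s′) (∙-cong (odd-multiple (exponent 2F) t′) (odd-multiple (exponent 3F) u′))) (identityˡ _))) eq)) c≉b
    ... | inj₂ (s′ , ≡.refl) | inj₁ (t′ , ≡.refl) | inj₁ (u′ , ≡.refl) = contradiction
      (trans (sym (trans (∙-cong (odd-multiple (exponent 1F) s′) (∙-cong (even-multiple (exponent 2F) t′) (even-multiple (exponent 3F) u′))) (trans (∙-congˡ (identityˡ _)) (identityʳ _)))) eq) a≉ε
    ... | inj₂ (s′ , ≡.refl) | inj₁ (t′ , ≡.refl) | inj₂ (u′ , ≡.refl) = contradiction (order2-inverse (exponent 1F)
      (trans (sym (trans (∙-cong (odd-multiple (exponent 1F) s′) (∙-cong (even-multiple (exponent 2F) t′) (odd-multiple (exponent 3F) u′))) (∙-congˡ (identityˡ _)))) eq)) c≉a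
    ... | inj₂ (s′ , ≡.refl) | inj₂ (t′ , ≡.refl) | inj₁ (u′ , ≡.refl) = contradiction (order2-inverse (exponent 1F)
      (trans (sym (trans (∙-cong (odd-multiple (exponent 1F) s′) (∙-cong (odd-multiple (exponent 2F) t′) (even-multiple (exponent 3F) u′))) (∙-congˡ (identityʳ _)))) eq)) b≉a
    ... | inj₂ (s′ , ≡.refl) | inj₂ (t′ , ≡.refl) | inj₂ (u′ , ≡.refl) = contradiction (order2-inverse (order2-∙ (exponent 1F) (exponent 2F))
      (trans (assoc a b c′) (trans (sym (∙-cong (odd-multiple (exponent 1F) s′) (∙-cong (odd-multiple (exponent 2F) t′) (odd-multiple (exponent 3F) u′)))) eq))) c≉ab

    -- Expanding `f 0F` as `a + b + c` reduces to independent elements. Doubles vanish here, so the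
    -- value of a sequence in the monoid is 0 and all four multiplicities have the same parity.
    regroup : ∀ i j k l → value f (i ∷ j ∷ k ∷ l ∷ []) ≈ (i + j) · a ∙ ((i + k) · b ∙ (i + l) · c′)
    regroup i j k l = begin
      i · f 0F ∙ (j · a ∙ (k · b ∙ (l · c′ ∙ ε)))
        ≈⟨ ∙-cong (×-congʳ i (trans f₀≈ (assoc a b c′))) (∙-congˡ (∙-congˡ (identityʳ _))) ⟩
      i · (a ∙ (b ∙ c′)) ∙ (j · a ∙ (k · b ∙ l · c′))
        ≈⟨ ∙-congʳ (trans (×-distrib-+ a (b ∙ c′) i) (∙-congˡ (×-distrib-+ b c′ i))) ⟩
      (i · a ∙ (i · b ∙ i · c′)) ∙ (j · a ∙ (k · b ∙ l · c′))
        ≈⟨ trans (interchange _ _ _ _) (∙-congˡ (interchange _ _ _ _)) ⟩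
      (i · a ∙ j · a) ∙ ((i · b ∙ k · b) ∙ (i · c′ ∙ l · c′))
        ≈⟨ ∙-cong (×-homo-+ a i j) (∙-cong (×-homo-+ b i k) (×-homo-+ c′ i l)) ⟨
      (i + j) · a ∙ ((i + k) · b ∙ (i + l) · c′) ∎

    V : Seq 4
    V = 1 ∷ 1 ∷ 1 ∷ 1 ∷ []

    even-partner : ∀ i j → ∃ (λ h → i + i + j ≡ h + h) → ∃ λ j′ → j ≡ j′ + j′
    even-partner i j (h , eq) with halve j
    ... | inj₁ j-even = j-even
    ... | inj₂ (j′ , ≡.refl) = contradiction
      (≡.trans (≡.sym eq) (solve 2 (λ i j → i :+ i :+ (con 1 :+ (j :+ j)) := con 1 :+ (i :+ j :+ (i :+ j))) ≡.refl i j′))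
      (m+m≢1+n+n h (i + j′))
      where open +-*-Solver

    odd-partner : ∀ i j → ∃ (λ h → suc (i + i) + j ≡ h + h) → ∃ λ j′ → j ≡ suc (j′ + j′)
    odd-partner i j (h , eq) with halve j
    ... | inj₂ j-odd = j-odd
    ... | inj₁ (j′ , ≡.refl) = contradiction
      (≡.trans (≡.sym eq) (solve 2 (λ i j → con 1 :+ (i :+ i) :+ (j :+ j) := con 1 :+ (i :+ j :+ (i :+ j))) ≡.refl i j′))
      (m+m≢1+n+n h (i + j′))
      where open +-*-Solver

    classify : ∀ x → IsPMZeroSum G f x → (∃ λ y → x ≡ y ⊕ y) ⊎ (∃ λ y → x ≡ V ⊕ (y ⊕ y))
    classify (i ∷ j ∷ k ∷ l ∷ []) Mx with M-elim₂ {f = f} Mx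
    ... | q , r , _ , sum≈ with independent (i + j) (i + k) (i + l)
      (trans (sym (regroup i j k l)) (trans sum≈ (trans (value-square f q) (∑-ε λ m → ·-annihilated (lookup q m) (exponent m)))))
      | halve i
    ... | ij , ik , il | inj₁ (i′ , ≡.refl) with even-partner i′ j ij | even-partner i′ k ik | even-partner i′ l il
    ... | j′ , ≡.refl | k′ , ≡.refl | l′ , ≡.refl = inj₁ (i′ ∷ j′ ∷ k′ ∷ l′ ∷ [] , ≡.refl)
    classify (i ∷ j ∷ k ∷ l ∷ []) Mx | q , r , _ , sum≈ | ij , ik , il | inj₂ (i′ , ≡.refl)
      with odd-partner i′ j ij | odd-partner i′ k ik | odd-partner i′ l il
    ... | j′ , ≡.refl | k′ , ≡.refl | l′ , ≡.refl = inj₂ (i′ ∷ j′ ∷ k′ ∷ l′ ∷ [] , ≡.refl)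

    configuration : Configuration G f 2
    configuration = record
      { 0<d = s≤s z≤n
      ; nonzero = λ
          { 0F f₀≈ε → c≉ab (order2-inverse (order2-∙ (exponent 1F) (exponent 2F)) (trans (sym f₀≈) f₀≈ε))
          ; 1F → a≉ε ; 2F → b≉ε ; 3F → c≉ε }
      ; V₀ = V
      ; special = special
      ; classify = λ x Mx → case classify x Mx of λ
          { (inj₁ even) → inj₁ even ; (inj₂ (y , eq)) → inj₂ (V , y , special , eq) } }
      where
      special : Special G f 2 V
      special = M-intro {f = f} (1 ∷ 0 ∷ 0 ∷ 0 ∷ []) (0 ∷ 1 ∷ 1 ∷ 1 ∷ []) (begin
        value f (1 ∷ 0 ∷ 0 ∷ 0 ∷ [])         ≈⟨ value-single f 0F 1 ⟩
        1 · f 0F                             ≈⟨ ×-homo-1 (f 0F) ⟩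
        f 0F                                 ≈⟨ f₀≈ ⟩
        a ∙ b ∙ c′                           ≈⟨ assoc a b c′ ⟩
        a ∙ (b ∙ c′)                         ≈⟨ ∙-cong (×-homo-1 a) (∙-cong (×-homo-1 b) (×-homo-1 c′)) ⟨
        1 · a ∙ (1 · b ∙ 1 · c′)             ≈⟨ regroup 0 1 1 1 ⟨
        value f (0 ∷ 1 ∷ 1 ∷ 1 ∷ [])         ∎) , ≡.refl , 0 , ≡.refl

-- Existence of a configuration in groups of even order

-- The points moved upwards and those moved downwards are equinumerous.
involution-odd : ∀ {n} (σ : Fin n → Fin n) → (∀ i → σ (σ i) ≡ i) →
                 ∀ i₀ → σ i₀ ≡ i₀ → (∀ i → σ i ≡ i → i ≡ i₀) → ¬ Even n
involution-odd {suc n} σ σσ i₀ σi₀ unique (divides h eq) = m+m≢1+n+n h (ℕΣ.sum up) $ begin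
  h + h                                           ≡⟨ ≡.cong (h +_) (+-identityʳ h) ⟨
  2 * h                                           ≡⟨ *-comm 2 h ⟩
  h * 2                                           ≡⟨ eq ⟨
  suc n                                           ≡⟨ *-identityʳ (suc n) ⟨
  suc n * 1                                       ≡⟨ replicate-1 (suc n) ⟨
  ℕΣ.sum (λ (_ : Fin (suc n)) → 1)                ≡⟨ ℕΣ.sum-cong-≗ classified ⟨
  ℕΣ.sum (λ i → fixed i + (up i + up (σ i)))      ≡⟨ ℕΣ.∑-distrib-+ fixed (λ i → up i + up (σ i)) ⟩
  ℕΣ.sum fixed + ℕΣ.sum (λ i → up i + up (σ i))   ≡⟨ ≡.cong₂ _+_ fixed-sum (ℕΣ.∑-distrib-+ up (up ∘ σ)) ⟩
  1 + (ℕΣ.sum up + ℕΣ.sum (up ∘ σ))               ≡⟨ ≡.cong (λ s → 1 + (ℕΣ.sum up + s)) (ℕΣ.sum-permute up (permutation σ σ σσ σσ)) ⟨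
  1 + (ℕΣ.sum up + ℕΣ.sum up)                     ∎
  where
  open ≡.≡-Reasoning
  replicate-1 : ∀ m → ℕΣ.sum (λ (_ : Fin m) → 1) ≡ m * 1
  replicate-1 zero    = ≡.refl
  replicate-1 (suc m) = ≡.cong suc (replicate-1 m)
  indicator : ∀ {p} {P : Set p} → Dec P → ℕ
  indicator (yes _) = 1
  indicator (no _)  = 0
  indicator-yes : ∀ {p} {P : Set p} (P? : Dec P) → P → indicator P? ≡ 1
  indicator-yes (yes _) _ = ≡.refl
  indicator-yes (no ¬p) p = contradiction p ¬p
  indicator-no : ∀ {p} {P : Set p} (P? : Dec P) → ¬ P → indicator P? ≡ 0
  indicator-no (yes p) ¬p = contradiction p ¬p
  indicator-no (no _)  _  = ≡.refl
  up fixed : Fin (suc n) → ℕ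
  up i = indicator (i Fin.<? σ i)
  fixed i = indicator (σ i Fin.≟ i)
  -- An index `i` moved downwards is counted by `up (σ i)`, because `σ i` is moved back up to `i`.
  classified : ∀ i → fixed i + (up i + up (σ i)) ≡ 1
  classified i with Fin.<-cmp i (σ i)
  ... | tri< i<σi i≢σi _ = ≡.cong₂ _+_ (indicator-no (σ i Fin.≟ i) (i≢σi ∘ ≡.sym)) $ ≡.cong₂ _+_
    (indicator-yes (i Fin.<? σ i) i<σi)
    (indicator-no (σ i Fin.<? σ (σ i)) λ lt → Fin.<-asym i<σi (≡.subst (σ i F.<_) (σσ i) lt))
  ... | tri≈ _ i≡σi _ = ≡.cong₂ _+_ (indicator-yes (σ i Fin.≟ i) (≡.sym i≡σi)) $ ≡.cong₂ _+_
    (indicator-no (i Fin.<? σ i) (Fin.<-irrefl i≡σi))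
    (indicator-no (σ i Fin.<? σ (σ i)) (Fin.<-irrefl (≡.cong σ i≡σi)))
  ... | tri> i≮σi i≢σi σi<i = ≡.cong₂ _+_ (indicator-no (σ i Fin.≟ i) (i≢σi ∘ ≡.sym)) $ ≡.cong₂ _+_
    (indicator-no (i Fin.<? σ i) i≮σi)
    (indicator-yes (σ i Fin.<? σ (σ i)) (≡.subst (σ i F.<_) (≡.sym (σσ i)) σi<i))
  fixed-sum : ℕΣ.sum fixed ≡ 1
  fixed-sum = ≡.trans (ℕΣ.sum-remove {i = i₀} fixed) $ ≡.cong₂ _+_ (indicator-yes (σ i₀ Fin.≟ i₀) σi₀) $
    ≡.trans (ℕΣ.sum-cong-≗ λ j → indicator-no (σ (F.punchIn i₀ j) Fin.≟ F.punchIn i₀ j) λ σi≡i → Fin.punchInᵢ≢i i₀ j (unique _ σi≡i))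
      (ℕΣ.sum-replicate-zero n)

least : ∀ {p} {P : ℕ → Set p} → (∀ m → Dec (P m)) → ∀ m → P m → ∃ λ m → P m × ∀ m′ → P m′ → m ≤ m′
least P? zero    p = 0 , p , λ _ _ → z≤n
least P? (suc m) p with P? 0
... | yes p₀ = 0 , p₀ , λ _ _ → z≤n
... | no ¬p₀ with least (P? ∘ suc) m p
... | k , pk , minimal = suc k , pk , λ { zero p₀ → contradiction p₀ ¬p₀ ; (suc m′) p′ → s≤s (minimal m′ p′) }

avoid : ∀ {n k} → k < n → (v : Vec (Fin n) k) → ∃ λ i → ∀ j → i ≢ lookup v j
avoid {n} {k} k<n v with Fin.any? (λ i → Fin.all? (λ j → ¬? (i Fin.≟ lookup v j)))
... | yes found = found
... | no none = contradiction
  (≡.trans (proj₂ (hit i)) (≡.trans (≡.cong (lookup v) same) (≡.sym (proj₂ (hit i′)))))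
  (Fin.<⇒≢ i<i′)
  where
  hit : ∀ i → ∃ λ j → i ≡ lookup v j
  hit i with Fin.any? (λ j → i Fin.≟ lookup v j)
  ... | yes found = found
  ... | no misses = contradiction (i , λ j eq → misses (j , eq)) none
  collision = Fin.pigeonhole k<n (proj₁ ∘ hit)
  i = proj₁ collision
  i′ = proj₁ (proj₂ collision)
  i<i′ = proj₁ (proj₂ (proj₂ collision))
  same = proj₂ (proj₂ (proj₂ collision))

module EvenOrder {c ℓ} (G : AbelianGroup c ℓ) (n : ℕ) (e : FiniteEnum G n) (5≤n : 5 ≤ n) (2∣n : Even n) where
  open Finite G n e
  open Configurations G
  open import Relation.Binary.Reasoning.Setoid setoid
  open import Algebra.Properties.Group group using (⁻¹-involutive; ε⁻¹≈ε)
  open import Algebra.Properties.CommutativeSemigroup commutativeSemigroup using (interchange)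

  Exists : Set _
  Exists = ∃₂ λ k d → Σ (Fin (suc k) → Fin n) λ g → Even d × Configuration G (el ∘ g) d

  ≢⇒≉ : ∀ {i j} → i ≢ j → ¬ el i ≈ el j
  ≢⇒≉ i≢j = i≢j ∘ el-injective

  ≢index : ∀ {i g} → i ≢ index g → ¬ el i ≈ g
  ≢index i≢ eli≈g = i≢ (el-injective (trans eli≈g (sym (el-index _))))

  -- Cauchy's theorem at 2: the solutions of `2x = 0` are the fixed points of negation, and 0 as the
  -- only one would make `n` odd.
  order2-element : ∃ λ i → ¬ el i ≈ ε × el i ∙ el i ≈ ε
  order2-element with Fin.any? (λ i → ¬? (i Fin.≟ i₀) ×-dec ((el i ∙ el i) ≈? ε))
  ... | yes (i , i≢i₀ , ii≈ε) = i , el-nonzero i≢i₀ , ii≈ε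
  ... | no none = contradiction 2∣n (involution-odd negate negate-involutive i₀ fixed unique)
    where
    negate : Fin n → Fin n
    negate i = index (el i ⁻¹)
    negate-involutive : ∀ i → negate (negate i) ≡ i
    negate-involutive i = el-injective (trans (el-index _) (trans (⁻¹-cong (el-index _)) (⁻¹-involutive (el i))))
    fixed : negate i₀ ≡ i₀
    fixed = el-injective (trans (el-index _) (trans (⁻¹-cong (el-index ε)) (trans ε⁻¹≈ε (sym (el-index ε)))))
    unique : ∀ i → negate i ≡ i → i ≡ i₀
    unique i eq with i Fin.≟ i₀
    ... | yes i≡i₀ = i≡i₀
    ... | no i≢i₀ = contradiction (i , i≢i₀ , (begin
      el i ∙ el i             ≈⟨ ∙-congˡ (reflexive (≡.cong el eq)) ⟨
      el i ∙ el (negate i)    ≈⟨ ∙-congˡ (el-index _) ⟩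
      el i ∙ el i ⁻¹          ≈⟨ inverseʳ _ ⟩
      ε                       ∎)) none

  -- For `b = u + a` the odd factor `2k + 1` kills `u` and fixes `a`. So odd `r` with `r b = a`
  -- exist, and the least one is taken.
  odd-order⇒configuration : ∀ u k → ¬ u ≈ ε → suc (k + k) · u ≈ ε → Exists
  odd-order⇒configuration u k u≉ε ku≈ε with order2-element
  ... | i , a≉ε , aa≈ε with least (λ m → (suc (m + m) · b) ≈? el i) k (begin
      suc (k + k) · b                      ≈⟨ ×-congʳ (suc (k + k)) (el-index (u ∙ el i)) ⟩
      suc (k + k) · (u ∙ el i)             ≈⟨ ×-distrib-+ u (el i) (suc (k + k)) ⟩
      suc (k + k) · u ∙ suc (k + k) · el i ≈⟨ ∙-cong ku≈ε (odd-multiple aa≈ε k) ⟩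
      ε ∙ el i                             ≈⟨ identityˡ _ ⟩
      el i                                 ∎)
    where b = el (index (u ∙ el i))
  -- `r = 1` would mean `u = 0`; hence `d = r - 1` is positive.
  ... | zero , b≈a , _ = contradiction (∙-cancelʳ (el i) _ _ (begin
      u ∙ el i                    ≈⟨ el-index _ ⟨
      el (index (u ∙ el i))       ≈⟨ ×-homo-1 _ ⟨
      1 · el (index (u ∙ el i))   ≈⟨ b≈a ⟩
      el i                        ≈⟨ identityˡ _ ⟨
      ε ∙ el i                    ∎)) u≉ε
  ... | m@(suc _) , rb≈a , minimal = 1 , m + m , lookup (i ∷ index (u ∙ el i) ∷ []) , m+m-even m ,
    OddOrder.configuration (el ∘ lookup (i ∷ index (u ∙ el i) ∷ [])) m a≉ε aa≈ε (s≤s z≤n) rb≈a minimal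

  order8⇒configuration : ∀ i → 8 · el i ≈ ε → ¬ 4 · el i ≈ ε → Exists
  order8⇒configuration i 8i≈ε 4i≉ε = 1 , 2 , lookup (i ∷ index (3 · el i) ∷ []) , ∣-refl ,
    Order8.configuration (el ∘ lookup (i ∷ index (3 · el i) ∷ [])) (el-index (3 · el i)) 8i≈ε 4i≉ε

  -- Doubling g repeatedly, one reaches either an element of odd order or one of order 8.
  4g≉ε⇒configuration : ∀ N → 0 < N → ∀ g → ¬ 4 · g ≈ ε → N · (4 · g) ≈ ε → Exists
  4g≉ε⇒configuration = <-rec _ go
    where
    go : ∀ N → (∀ {N′} → N′ < N → 0 < N′ → ∀ g → ¬ 4 · g ≈ ε → N′ · (4 · g) ≈ ε → Exists) →
         0 < N → ∀ g → ¬ 4 · g ≈ ε → N · (4 · g) ≈ ε → Exists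
    go N rec 0<N g 4g≉ε N4g≈ε with halve N | (4 · (2 · g)) ≈? ε
    ... | inj₂ (h , ≡.refl) | _ = odd-order⇒configuration (4 · g) h 4g≉ε N4g≈ε
    ... | inj₁ _ | yes 8g≈ε = order8⇒configuration (index g)
      (trans (×-congʳ 8 (el-index g)) (trans (sym (×-assocˡ g 4 2)) 8g≈ε))
      (4g≉ε ∘ trans (sym (×-congʳ 4 (el-index g))))
    ... | inj₁ (zero , ≡.refl) | no _ = contradiction 0<N λ ()
    ... | inj₁ (h@(suc _) , ≡.refl) | no 8g≉ε = rec (m<m+n h (s≤s z≤n)) (s≤s z≤n) (2 · g) 8g≉ε (begin
      h · (4 · (2 · g))           ≈⟨ ×-congʳ h (·-comm 4 2 g) ⟩
      h · (2 · (4 · g))           ≈⟨ ×-assocˡ (4 · g) h 2 ⟩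
      (h * 2) · (4 · g)           ≡⟨ ≡.cong (_· (4 · g)) (≡.trans (*-comm h 2) (≡.cong (h +_) (+-identityʳ h))) ⟩
      (h + h) · (4 · g)           ≈⟨ N4g≈ε ⟩
      ε                           ∎)

  order2⇒configuration : ∀ i g → el i ∙ el i ≈ ε → ¬ el i ≈ ε → ¬ el i ≈ el g ∙ el g →
    ¬ el g ∙ el g ≈ ε → (el g ∙ el g) ∙ (el g ∙ el g) ≈ ε → Exists
  order2⇒configuration i g ii≈ε i≉ε i≉gg gg≉ε gggg≈ε = 2 , 2 , lookup v , ∣-refl ,
    Exponent4.configuration (el ∘ lookup v) ii≈ε i≉ε i≉gg (el-index _) gg≉ε gggg≈ε
    where v = i ∷ index (el i ∙ (el g ∙ el g)) ∷ g ∷ []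

  -- Take `w` outside `{0, g, 2g, 3g}`. Then `h` is `w` if `2w = 0`, `w + g` if `2w = 2g`, and `2w`
  -- otherwise. For `w + g`, avoiding `3g = -g` and `g` keeps `h` away from 0 and `2g`.
  exponent4⇒configuration : (∀ i → (el i ∙ el i) ∙ (el i ∙ el i) ≈ ε) → ∀ g → ¬ el g ∙ el g ≈ ε → Exists
  exponent4⇒configuration exponent4 g gg≉ε with
    avoid 5≤n (i₀ ∷ g ∷ index (el g ∙ el g) ∷ index (el g ∙ el g ∙ el g) ∷ [])
  ... | w , avoids with (el w ∙ el w) ≈? ε | (el w ∙ el w) ≈? (el g ∙ el g)
  ... | yes ww≈ε | _ = order2⇒configuration w g ww≈ε (el-nonzero (avoids 0F)) (≢index (avoids 2F)) gg≉ε (exponent4 g)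
  ... | no ww≉ε | no ww≉gg = order2⇒configuration (index (el w ∙ el w)) g
      (trans (∙-cong (el-index _) (el-index _)) (exponent4 w)) (ww≉ε ∘ trans (sym (el-index _))) (ww≉gg ∘ trans (sym (el-index _))) gg≉ε (exponent4 g)
  ... | no _ | yes ww≈gg = order2⇒configuration (index (el w ∙ el g)) g
      (trans (∙-cong (el-index _) (el-index _)) (trans (interchange _ _ _ _) (trans (∙-congʳ ww≈gg) (exponent4 g))))
      (λ wg≈ε → ≢index (avoids 3F) (∙-cancelʳ (el g) _ _ (begin
        el w ∙ el g                         ≈⟨ el-index _ ⟨
        el (index (el w ∙ el g))            ≈⟨ wg≈ε ⟩
        ε                                   ≈⟨ exponent4 g ⟨
        (el g ∙ el g) ∙ (el g ∙ el g)       ≈⟨ assoc _ (el g) (el g) ⟨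
        el g ∙ el g ∙ el g ∙ el g           ∎)))
      (λ wg≈gg → ≢⇒≉ (avoids 1F) (∙-cancelʳ (el g) _ _ (trans (sym (el-index _)) wg≈gg)))
      gg≉ε (exponent4 g)

  -- The last choice is the critical one: `c` must avoid the four elements 0, `a`, `b`, `a + b`.
  exponent2⇒configuration : (∀ i → el i ∙ el i ≈ ε) → Exists
  exponent2⇒configuration exponent2 with avoid (<-trans (s≤s (s≤s z≤n)) 5≤n) (i₀ ∷ [])
  ... | a , a-avoids with avoid (<-trans (s≤s (s≤s (s≤s z≤n))) 5≤n) (i₀ ∷ a ∷ [])
  ... | b , b-avoids with avoid 5≤n (i₀ ∷ a ∷ b ∷ index (el a ∙ el b) ∷ [])
  ... | c , c-avoids = 3 , 2 , lookup v , ∣-refl , Exponent2.configuration (el ∘ lookup v) (λ i → exponent2 (lookup v i)) (el-index _)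
      (el-nonzero (a-avoids 0F)) (el-nonzero (b-avoids 0F)) (≢⇒≉ (b-avoids 1F))
      (el-nonzero (c-avoids 0F)) (≢⇒≉ (c-avoids 1F)) (≢⇒≉ (c-avoids 2F)) (≢index (c-avoids 3F))
    where v = index (el a ∙ el b ∙ el c) ∷ a ∷ b ∷ c ∷ []

  4·≈ : ∀ g → 4 · g ≈ (g ∙ g) ∙ (g ∙ g)
  4·≈ g = trans (×-homo-+ g 2 2) (∙-cong (∙-congˡ (identityʳ g)) (∙-congˡ (identityʳ g)))

  -- Once `4G = 0`, no nonzero element has odd order; so odd order and order 8 both arise from an
  -- element with `4g ≠ 0`, and exponents 4 and 2 remain.
  configuration-exists : Exists
  configuration-exists with Fin.any? (λ i → ¬? ((4 · el i) ≈? ε))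
  ... | yes (i , 4i≉ε) = 4g≉ε⇒configuration n (≤-trans (s≤s z≤n) 5≤n) (el i) 4i≉ε (lagrange _)
  ... | no no-4 with Fin.any? (λ i → ¬? ((el i ∙ el i) ≈? ε))
  ... | yes (g , gg≉ε) = exponent4⇒configuration exponent4 g gg≉ε
    where
    exponent4 : ∀ i → (el i ∙ el i) ∙ (el i ∙ el i) ≈ ε
    exponent4 i with (4 · el i) ≈? ε
    ... | yes 4i≈ε = trans (sym (4·≈ (el i))) 4i≈ε
    ... | no 4i≉ε  = contradiction (i , 4i≉ε) no-4
  ... | no no-2 = exponent2⇒configuration exponent2
    where
    exponent2 : ∀ i → el i ∙ el i ≈ ε
    exponent2 i with (el i ∙ el i) ≈? ε
    ... | yes ii≈ε = ii≈ε
    ... | no ii≉ε  = contradiction (i , ii≉ε) no-2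

theorem4p18 : ∀ {c ℓ} (G : AbelianGroup c ℓ) (n : ℕ) (e : FiniteEnum G n) →
    5 ≤ n →
    (Even n ⇔ (Σ ℕ λ d → Even d × InΔ* (Bpm G e) d)) ×
    (Even n ⇔ (Σ ℕ λ d → Even d × InΔ₁ (Bpm G e) d))
theorem4p18 G n e 5≤n =
  mk⇔ (λ 2∣n → let _ , d , g , 2∣d , C = EvenOrder.configuration-exists G n e 5≤n 2∣n in
         d , 2∣d , configuration⇒Δ* G n e g C)
      (λ { (_ , 2∣d , d∈Δ*) → Finite.Δ*-even⇒even G n e 2∣d d∈Δ* }) ,
  mk⇔ (λ 2∣n → let _ , d , g , 2∣d , C = EvenOrder.configuration-exists G n e 5≤n 2∣n in
         d , 2∣d , configuration⇒Δ₁ G n e g C)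
      (λ { (_ , 2∣d , d∈Δ₁) → Finite.Δ₁-even⇒even G n e 2∣d d∈Δ₁ })
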